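{- Let $H$ be a graph and let $0<\delta\leqslant 1/2$. Suppose there is a polynomial-time algorithm which takes as input any $H$-free graph $G$ and outputs a set of at least $|V(G)|^{\delta}$ vertices of $G$ that is either a clique or an independent set. Then for every fixed $\varepsilon>0$, $H$ satisfies the improved approximation property with constant $\delta-\delta^2-\varepsilon$; that is, there is a polynomial-time algorithm which, given an $H$-free graph $G$ on $n$ vertices, outputs an independent set of $G$ of size at least $\alpha(G)/n^{1-(\delta-\delta^2-\varepsilon)}$.
   Context: All graphs are finite and simple. A graph $G$ is $H$-free if it has no induced subgraph isomorphic to $H$. $\alpha(G)$ denotes the maximum size of an independent set of $G$. Maximum Independent Set (MIS) is the problem of finding a maximum-size independent set. A (randomized) $\rho$-approximation algorithm for MIS outputs (with probability tending to $1$ as the number $n$ of vertices tends to infinity, in the randomized case) an independent set of size at least $\alpha(G)/\rho$. A graph $H$ satisfies the improved approximation property with constant $\varepsilon'>0$ if MIS admits a (randomized) polynomial-time $n^{1-\varepsilon'}$-approximation algorithm on every $H$-free $n$-vertex graph. -}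

module Defs where

open import Data.Bool.Base using (Bool; true; false)
import Data.Bool.Properties as Bool
open import Data.Fin.Base using (Fin)
import Data.Fin.Properties as Fin
open import Data.Fin.Subset using (Subset; inside; outside; _∈_; ∣_∣; ⊥)
open import Data.Fin.Subset.Properties using (_∈?_; ∉⊥; ∣⊥∣≡0)
import Data.Integer.Base as ℤ
open import Data.List.Base as List using (List; []; _∷_; _++_)
open import Data.List.Extrema.Nat using (max; argmax-sel; xs≤max)
import Data.List.Membership.Propositional as List
open import Data.List.Membership.Propositional.Properties
  using (∈-map⁺; ∈-map⁻; ∈-filter⁺; ∈-filter⁻; ∈-++⁺ˡ; ∈-++⁺ʳ)
open import Data.List.Relation.Unary.All using (lookup)
open import Data.List.Relation.Unary.Any using (here)
open import Data.Nat.Base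
  using (ℕ; zero; suc; _+_; _*_; _^_; _≤_; _⊔_; NonZero)
import Data.Nat.Properties as ℕ
open import Data.Product.Base using (Σ-syntax; ∃-syntax; _×_; _,_; proj₁; proj₂)
open import Data.Rational.Base as ℚ using (ℚ; 0ℚ; 1ℚ; ½)
import Data.Rational.Properties as ℚ
open import Data.Rational.Solver using (module +-*-Solver)
open import Data.Sum.Base using (_⊎_; inj₁; inj₂)
open import Data.Vec.Base as Vec using (Vec; []; _∷_; tabulate)
open import Function.Base using (id)
open import Function.Definitions using (Injective)
open import Relation.Binary.PropositionalEquality
  using (_≡_; _≢_; refl; sym; trans; cong; subst)
open import Relation.Nullary.Decidable using (Dec; _→-dec_)
open import Relation.Nullary.Negation using (¬_; contradiction)

------------------------------------------------------------------------
-- Real numbers: Cauchy sequences of rationals, with the usual order.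

record ℝ : Set where
  constructor mkℝ
  field
    seq    : ℕ → ℚ
    cauchy : ∀ ε → 0ℚ ℚ.< ε →
             ∃[ N ] (∀ m n → N ≤ m → N ≤ n → ℚ.∣ seq m ℚ.- seq n ∣ ℚ.< ε)

open ℝ public

infix  4 _<ℝ_ _≤ℝ_
infixl 6 _+ℝ_ _-ℝ_
infixl 7 _*ℝ_
infix  8 -ℝ_

-- The gap ε makes this the strict order of the limits.
_<ℝ_ : ℝ → ℝ → Set
x <ℝ y = ∃[ ε ] (0ℚ ℚ.< ε ×
         ∃[ N ] (∀ n → N ≤ n → seq x n ℚ.+ ε ℚ.≤ seq y n))

_≤ℝ_ : ℝ → ℝ → Set
x ≤ℝ y = ¬ (y <ℝ x)

private

  0<½* : ∀ {ε} → 0ℚ ℚ.< ε → 0ℚ ℚ.< ½ ℚ.* ε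
  0<½* {ε} 0<ε =
    subst (ℚ._< ½ ℚ.* ε) (ℚ.*-zeroʳ ½) (ℚ.*-monoʳ-<-pos ½ 0<ε)

  ½+½ : ∀ ε → ½ ℚ.* ε ℚ.+ ½ ℚ.* ε ≡ ε
  ½+½ ε = trans (sym (ℚ.*-distribʳ-+ ε ½ ½)) (ℚ.*-identityˡ ε)

  p≤p+q : ∀ p {q} → 0ℚ ℚ.≤ q → p ℚ.≤ p ℚ.+ q
  p≤p+q p {q} 0≤q =
    subst (ℚ._≤ p ℚ.+ q) (ℚ.+-identityʳ p) (ℚ.+-monoʳ-≤ p 0≤q)

  q≤p+q : ∀ {p} q → 0ℚ ℚ.≤ p → q ℚ.≤ p ℚ.+ q
  q≤p+q {p} q 0≤p = subst (q ℚ.≤_) (ℚ.+-comm q p) (p≤p+q q 0≤p)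

  0<1 : 0ℚ ℚ.< 1ℚ
  0<1 = ℚ.positive⁻¹ 1ℚ

  eventuallyBounded : (x : ℝ) →
    ∃[ B ] (0ℚ ℚ.≤ B × ∃[ N ] (∀ n → N ≤ n → ℚ.∣ seq x n ∣ ℚ.≤ B))
  eventuallyBounded x with cauchy x 1ℚ 0<1
  ... | N , close = B , 0≤B , N , bound
    where
    B = 1ℚ ℚ.+ ℚ.∣ seq x N ∣
    0≤B : 0ℚ ℚ.≤ B
    0≤B = ℚ.≤-trans (ℚ.<⇒≤ 0<1) (p≤p+q 1ℚ (ℚ.0≤∣p∣ (seq x N)))
    split : ∀ a b → a ≡ (a ℚ.- b) ℚ.+ b
    split = solve 2 (λ a b → a := (a :- b) :+ b) refl
      where open +-*-Solver
    bound : ∀ n → N ≤ n → ℚ.∣ seq x n ∣ ℚ.≤ B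
    bound n N≤n = begin
      ℚ.∣ seq x n ∣                                 ≡⟨ cong ℚ.∣_∣ (split (seq x n) (seq x N)) ⟩
      ℚ.∣ (seq x n ℚ.- seq x N) ℚ.+ seq x N ∣       ≤⟨ ℚ.∣p+q∣≤∣p∣+∣q∣ (seq x n ℚ.- seq x N) (seq x N) ⟩
      ℚ.∣ seq x n ℚ.- seq x N ∣ ℚ.+ ℚ.∣ seq x N ∣   ≤⟨ ℚ.+-monoˡ-≤ ℚ.∣ seq x N ∣ (ℚ.<⇒≤ (close n N N≤n ℕ.≤-refl)) ⟩
      B                                             ∎
      where open ℚ.≤-Reasoning

fromℚ : ℚ → ℝ
fromℚ q = mkℝ (λ _ → q) λ ε 0<ε → 0 , λ _ _ _ _ →
  subst (ℚ._< ε) (sym (cong ℚ.∣_∣ (ℚ.+-inverseʳ q))) 0<ε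

_+ℝ_ : ℝ → ℝ → ℝ
x +ℝ y = mkℝ (λ n → seq x n ℚ.+ seq y n) λ ε 0<ε →
  let M , closeˣ = cauchy x (½ ℚ.* ε) (0<½* 0<ε)
      N , closeʸ = cauchy y (½ ℚ.* ε) (0<½* 0<ε)
  in M ⊔ N , λ m n m≥ n≥ →
    let a = seq x m; b = seq x n; c = seq y m; d = seq y n in
    begin-strict
      ℚ.∣ (a ℚ.+ c) ℚ.- (b ℚ.+ d) ∣           ≡⟨ cong ℚ.∣_∣ (regroup a b c d) ⟩
      ℚ.∣ (a ℚ.- b) ℚ.+ (c ℚ.- d) ∣           ≤⟨ ℚ.∣p+q∣≤∣p∣+∣q∣ (a ℚ.- b) (c ℚ.- d) ⟩
      ℚ.∣ a ℚ.- b ∣ ℚ.+ ℚ.∣ c ℚ.- d ∣         <⟨ ℚ.+-mono-<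
                                                  (closeˣ m n (ℕ.m⊔n≤o⇒m≤o M N m≥) (ℕ.m⊔n≤o⇒m≤o M N n≥))
                                                  (closeʸ m n (ℕ.m⊔n≤o⇒n≤o M N m≥) (ℕ.m⊔n≤o⇒n≤o M N n≥)) ⟩
      ½ ℚ.* ε ℚ.+ ½ ℚ.* ε                     ≡⟨ ½+½ ε ⟩
      ε                                       ∎
  where
  open ℚ.≤-Reasoning
  regroup : ∀ a b c d →
    (a ℚ.+ c) ℚ.- (b ℚ.+ d) ≡ (a ℚ.- b) ℚ.+ (c ℚ.- d)
  regroup = solve 4 (λ a b c d →
    (a :+ c) :- (b :+ d) := (a :- b) :+ (c :- d)) refl
    where open +-*-Solver

-ℝ_ : ℝ → ℝ
-ℝ x = mkℝ (λ n → ℚ.- seq x n) λ ε 0<ε →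
  let N , close = cauchy x ε 0<ε
  in N , λ m n m≥ n≥ →
    subst (ℚ._< ε) (flip (seq x m) (seq x n)) (close m n m≥ n≥)
  where
  flip : ∀ a b → ℚ.∣ a ℚ.- b ∣ ≡ ℚ.∣ ℚ.- a ℚ.- ℚ.- b ∣
  flip a b = trans (sym (ℚ.∣-p∣≡∣p∣ (a ℚ.- b)))
    (cong ℚ.∣_∣ (ℚ.neg-distrib-+ a (ℚ.- b)))

_-ℝ_ : ℝ → ℝ → ℝ
x -ℝ y = x +ℝ (-ℝ y)

_*ℝ_ : ℝ → ℝ → ℝ
x *ℝ y = mkℝ (λ n → seq x n ℚ.* seq y n) modulus
  where
  open ℚ.≤-Reasoning
  split : ∀ a b c d →
    a ℚ.* c ℚ.- b ℚ.* d ≡ a ℚ.* (c ℚ.- d) ℚ.+ d ℚ.* (a ℚ.- b)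
  split = solve 4 (λ a b c d →
    a :* c :- b :* d := a :* (c :- d) :+ d :* (a :- b)) refl
    where open +-*-Solver

  modulus : ∀ ε → 0ℚ ℚ.< ε → ∃[ N ] (∀ m n → N ≤ m → N ≤ n →
    ℚ.∣ seq x m ℚ.* seq y m ℚ.- seq x n ℚ.* seq y n ∣ ℚ.< ε)
  modulus ε 0<ε = K , close
    where
    Bˣ = proj₁ (eventuallyBounded x)
    Bʸ = proj₁ (eventuallyBounded y)
    0≤Bˣ = proj₁ (proj₂ (eventuallyBounded x))
    0≤Bʸ = proj₁ (proj₂ (eventuallyBounded y))
    N₁ = proj₁ (proj₂ (proj₂ (eventuallyBounded x)))
    N₂ = proj₁ (proj₂ (proj₂ (eventuallyBounded y)))

    B = 1ℚ ℚ.+ (Bˣ ℚ.+ Bʸ)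
    0≤Bˣ+Bʸ : 0ℚ ℚ.≤ Bˣ ℚ.+ Bʸ
    0≤Bˣ+Bʸ = ℚ.≤-trans 0≤Bˣ (p≤p+q Bˣ 0≤Bʸ)
    instance
      B-pos : ℚ.Positive B
      B-pos = ℚ.positive (ℚ.<-≤-trans 0<1 (p≤p+q 1ℚ 0≤Bˣ+Bʸ))
      B-nonNeg : ℚ.NonNegative B
      B-nonNeg = ℚ.pos⇒nonNeg B
      B-nonZero : ℚ.NonZero B
      B-nonZero = ℚ.pos⇒nonZero B
      1/B-pos : ℚ.Positive (ℚ.1/ B)
      1/B-pos = ℚ.1/pos⇒pos B
    Bˣ≤B : Bˣ ℚ.≤ B
    Bˣ≤B = ℚ.≤-trans (p≤p+q Bˣ 0≤Bʸ) (q≤p+q (Bˣ ℚ.+ Bʸ) (ℚ.<⇒≤ 0<1))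
    Bʸ≤B : Bʸ ℚ.≤ B
    Bʸ≤B = ℚ.≤-trans (q≤p+q Bʸ 0≤Bˣ) (q≤p+q (Bˣ ℚ.+ Bʸ) (ℚ.<⇒≤ 0<1))

    η = (ℚ.1/ B) ℚ.* (½ ℚ.* ε)
    0<η : 0ℚ ℚ.< η
    0<η = subst (ℚ._< η) (ℚ.*-zeroʳ (ℚ.1/ B))
      (ℚ.*-monoʳ-<-pos (ℚ.1/ B) (0<½* 0<ε))
    Bη : B ℚ.* η ≡ ½ ℚ.* ε
    Bη = trans (sym (ℚ.*-assoc B (ℚ.1/ B) (½ ℚ.* ε)))
      (trans (cong (ℚ._* (½ ℚ.* ε)) (ℚ.*-inverseʳ B)) (ℚ.*-identityˡ _))

    N₃ = proj₁ (cauchy x η 0<η)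
    N₄ = proj₁ (cauchy y η 0<η)
    K = (N₁ ⊔ N₂) ⊔ (N₃ ⊔ N₄)

    small : ∀ p q → ℚ.∣ p ∣ ℚ.≤ B → ℚ.∣ q ∣ ℚ.< η → ℚ.∣ p ℚ.* q ∣ ℚ.< ½ ℚ.* ε
    small p q p≤B q<η = begin-strict
      ℚ.∣ p ℚ.* q ∣         ≡⟨ ℚ.∣p*q∣≡∣p∣*∣q∣ p q ⟩
      ℚ.∣ p ∣ ℚ.* ℚ.∣ q ∣   ≤⟨ ℚ.*-monoʳ-≤-nonNeg ℚ.∣ q ∣ {{ℚ.∣-∣-nonNeg q}} p≤B ⟩
      B ℚ.* ℚ.∣ q ∣         <⟨ ℚ.*-monoʳ-<-pos B q<η ⟩
      B ℚ.* η               ≡⟨ Bη ⟩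
      ½ ℚ.* ε               ∎

    close : ∀ m n → K ≤ m → K ≤ n →
      ℚ.∣ seq x m ℚ.* seq y m ℚ.- seq x n ℚ.* seq y n ∣ ℚ.< ε
    close m n m≥ n≥ = begin-strict
      ℚ.∣ a ℚ.* c ℚ.- b ℚ.* d ∣                                 ≡⟨ cong ℚ.∣_∣ (split a b c d) ⟩
      ℚ.∣ a ℚ.* (c ℚ.- d) ℚ.+ d ℚ.* (a ℚ.- b) ∣                 ≤⟨ ℚ.∣p+q∣≤∣p∣+∣q∣ (a ℚ.* (c ℚ.- d)) (d ℚ.* (a ℚ.- b)) ⟩
      ℚ.∣ a ℚ.* (c ℚ.- d) ∣ ℚ.+ ℚ.∣ d ℚ.* (a ℚ.- b) ∣           <⟨ ℚ.+-mono-< (small a (c ℚ.- d) a≤B c-d<η) (small d (a ℚ.- b) d≤B a-b<η) ⟩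
      ½ ℚ.* ε ℚ.+ ½ ℚ.* ε                                       ≡⟨ ½+½ ε ⟩
      ε                                                         ∎
      where
      a = seq x m
      b = seq x n
      c = seq y m
      d = seq y n
      lower : ∀ {k} → K ≤ k → N₁ ⊔ N₂ ≤ k
      lower = ℕ.m⊔n≤o⇒m≤o (N₁ ⊔ N₂) (N₃ ⊔ N₄)
      upper : ∀ {k} → K ≤ k → N₃ ⊔ N₄ ≤ k
      upper = ℕ.m⊔n≤o⇒n≤o (N₁ ⊔ N₂) (N₃ ⊔ N₄)
      a≤B : ℚ.∣ a ∣ ℚ.≤ B
      a≤B = ℚ.≤-trans
        (proj₂ (proj₂ (proj₂ (eventuallyBounded x))) m (ℕ.m⊔n≤o⇒m≤o N₁ N₂ (lower m≥))) Bˣ≤B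
      d≤B : ℚ.∣ d ∣ ℚ.≤ B
      d≤B = ℚ.≤-trans
        (proj₂ (proj₂ (proj₂ (eventuallyBounded y))) n (ℕ.m⊔n≤o⇒n≤o N₁ N₂ (lower n≥))) Bʸ≤B
      a-b<η : ℚ.∣ a ℚ.- b ∣ ℚ.< η
      a-b<η = proj₂ (cauchy x η 0<η) m n
        (ℕ.m⊔n≤o⇒m≤o N₃ N₄ (upper m≥)) (ℕ.m⊔n≤o⇒m≤o N₃ N₄ (upper n≥))
      c-d<η : ℚ.∣ c ℚ.- d ∣ ℚ.< η
      c-d<η = proj₂ (cauchy y η 0<η) m n
        (ℕ.m⊔n≤o⇒n≤o N₃ N₄ (upper m≥)) (ℕ.m⊔n≤o⇒n≤o N₃ N₄ (upper n≥))

0ℝ ½ℝ 1ℝ : ℝ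
0ℝ = fromℚ 0ℚ
½ℝ = fromℚ ½
1ℝ = fromℚ 1ℚ

-- Comparisons with n ^ x, for a natural number n and a real x > 0 (and
-- 0 ^ x = 0).  The real power is the supremum of the n ^ (p/q) with
-- 0 < p/q < x, equivalently the infimum of those with p/q > x, and
-- n ^ (p/q) ≤ s means n ^ p ≤ s ^ q.

-- n ^ x ≤ s
PowerAtMost : ℕ → ℝ → ℕ → Set
PowerAtMost n x s = ∀ p q → .{{_ : NonZero p}} .{{_ : NonZero q}} →
  fromℚ (ℤ.+ p ℚ./ q) <ℝ x → n ^ p ≤ s ^ q

-- a / n ^ x ≤ s, read as a ≤ s * n ^ x so that n = 0 makes sense
QuotientAtMost : ℕ → ℕ → ℝ → ℕ → Set
QuotientAtMost a n x s = ∀ p q → .{{_ : NonZero q}} →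
  x <ℝ fromℚ (ℤ.+ p ℚ./ q) → a ^ q ≤ s ^ q * n ^ p

------------------------------------------------------------------------
-- Finite simple graphs, with vertex set Fin n.

record Graph (n : ℕ) : Set where
  field
    adj         : Fin n → Fin n → Bool
    symmetric   : ∀ i j → adj i j ≡ adj j i
    irreflexive : ∀ i → adj i i ≡ false

open Graph public

record InducedSubgraph {h n : ℕ} (H : Graph h) (G : Graph n) : Set where
  field
    embed     : Fin h → Fin n
    injective : Injective _≡_ _≡_ embed
    preserves : ∀ i j → adj G (embed i) (embed j) ≡ adj H i j

_-Free_ : ∀ {h n} → Graph h → Graph n → Set
H -Free G = ¬ InducedSubgraph H G

IsClique : ∀ {n} → Graph n → Subset n → Set
IsClique G S = ∀ i j → i ∈ S → j ∈ S → i ≢ j → adj G i j ≡ true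

IsIndependent : ∀ {n} → Graph n → Subset n → Set
IsIndependent G S = ∀ i j → i ∈ S → j ∈ S → adj G i j ≡ false

isIndependent? : ∀ {n} (G : Graph n) (S : Subset n) → Dec (IsIndependent G S)
isIndependent? G S = Fin.all? λ i → Fin.all? λ j →
  (i ∈? S) →-dec ((j ∈? S) →-dec (adj G i j Bool.≟ false))

subsets : ∀ n → List (Subset n)
subsets zero    = [] ∷ []
subsets (suc n) = List.map (inside ∷_) (subsets n) ++ List.map (outside ∷_) (subsets n)

independentSizes : ∀ {n} → Graph n → List ℕ
independentSizes {n} G = List.map ∣_∣ (List.filter (isIndependent? G) (subsets n))

α : ∀ {n} → Graph n → ℕ
α G = max 0 (independentSizes G)

∈-subsets : ∀ {n} (S : Subset n) → S List.∈ subsets n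
∈-subsets []            = here refl
∈-subsets (inside ∷ S)  = ∈-++⁺ˡ (∈-map⁺ (inside ∷_) (∈-subsets S))
∈-subsets (outside ∷ S) = ∈-++⁺ʳ _ (∈-map⁺ (outside ∷_) (∈-subsets S))

α-upper : ∀ {n} (G : Graph n) S → IsIndependent G S → ∣ S ∣ ≤ α G
α-upper G S ind = lookup (xs≤max 0 (independentSizes G))
  (∈-map⁺ ∣_∣ (∈-filter⁺ (isIndependent? G) (∈-subsets S) ind))

α-attained : ∀ {n} (G : Graph n) → ∃[ S ] (IsIndependent G S × ∣ S ∣ ≡ α G)
α-attained {n} G with argmax-sel id 0 (independentSizes G)
... | inj₁ α≡0 = ⊥ , (λ i _ i∈⊥ _ → contradiction i∈⊥ ∉⊥) , trans (∣⊥∣≡0 n) (sym α≡0)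
... | inj₂ α∈  =
  let S , S∈ , α≡ = ∈-map⁻ ∣_∣ α∈
      _ , ind = ∈-filter⁻ (isIndependent? G) {xs = subsets n} S∈
  in S , ind , sym α≡

------------------------------------------------------------------------
-- Model of computation: Jones's one-variable WHILE language over binary
-- trees (N. D. Jones, Computability and Complexity from a Programming
-- Perspective, 1997), with a conditional, and with his unit-cost time
-- measure.  Trees are shared, so every operation below is a bounded number
-- of pointer operations, and polynomial time in this language is polynomial
-- time on a Turing machine.

infixr 5 _∙_

data Tree : Set where
  nil : Tree
  _∙_ : Tree → Tree → Tree

data Expr : Set where
  X    : Expr
  nil  : Expr
  cons : Expr → Expr → Expr
  hd   : Expr → Expr
  tl   : Expr → Expr

head tail : Tree → Tree
head nil     = nil
head (t ∙ _) = t
tail nil     = nil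
tail (_ ∙ t) = t

⟦_⟧ : Expr → Tree → Tree
⟦ X ⟧        t = t
⟦ nil ⟧      t = nil
⟦ cons E F ⟧ t = ⟦ E ⟧ t ∙ ⟦ F ⟧ t
⟦ hd E ⟧     t = head (⟦ E ⟧ t)
⟦ tl E ⟧     t = tail (⟦ E ⟧ t)

cost : Expr → ℕ
cost X          = 1
cost nil        = 1
cost (cons E F) = 1 + cost E + cost F
cost (hd E)     = 1 + cost E
cost (tl E)     = 1 + cost E

infixr 5 _⨾_
infix  6 X:=_ while_loop_ if_then_else_

data Command : Set where
  X:=_          : Expr → Command
  _⨾_           : Command → Command → Command
  if_then_else_ : Expr → Command → Command → Command
  while_loop_     : Expr → Command → Command

-- C ⊢ s ⇒ t [ k ]: started with X = s, the command C halts with X = t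
-- after time k.  In tests, nil is false and every other tree is true.
infix 4 _⊢_⇒_[_]

data _⊢_⇒_[_] : Command → Tree → Tree → ℕ → Set where

  assign : ∀ {E s} → X:= E ⊢ s ⇒ ⟦ E ⟧ s [ 1 + cost E ]

  sequence : ∀ {C D s t u k l} →
    C ⊢ s ⇒ t [ k ] → D ⊢ t ⇒ u [ l ] → C ⨾ D ⊢ s ⇒ u [ k + l ]

  if-true : ∀ {E C D s t k a b} → ⟦ E ⟧ s ≡ a ∙ b →
    C ⊢ s ⇒ t [ k ] → if E then C else D ⊢ s ⇒ t [ 1 + cost E + k ]

  if-false : ∀ {E C D s t k} → ⟦ E ⟧ s ≡ nil →
    D ⊢ s ⇒ t [ k ] → if E then C else D ⊢ s ⇒ t [ 1 + cost E + k ]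

  while-true : ∀ {E C s t u k l a b} → ⟦ E ⟧ s ≡ a ∙ b →
    C ⊢ s ⇒ t [ k ] → while E loop C ⊢ t ⇒ u [ l ] →
    while E loop C ⊢ s ⇒ u [ 1 + cost E + k + l ]

  while-false : ∀ {E C s} → ⟦ E ⟧ s ≡ nil →
    while E loop C ⊢ s ⇒ s [ 1 + cost E ]

encodeBool : Bool → Tree
encodeBool false = nil
encodeBool true  = nil ∙ nil

encodeVec : ∀ {a} {A : Set a} {n} → (A → Tree) → Vec A n → Tree
encodeVec enc []       = nil
encodeVec enc (x ∷ xs) = enc x ∙ encodeVec enc xs

-- A set of vertices is encoded as its characteristic vector.
encodeSubset : ∀ {n} → Subset n → Tree
encodeSubset = encodeVec encodeBool

-- A graph is encoded as the list of rows of its adjacency matrix.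
encodeGraph : ∀ {n} → Graph n → Tree
encodeGraph G = encodeVec (encodeVec encodeBool) (tabulate λ i → tabulate (adj G i))

-- Nothing is required of the command on graphs outside P.  The input has
-- size Θ(n²), so being polynomial in it amounts to being polynomial in n.
PolyTimeAlgorithm : (P : ∀ {n} → Graph n → Set)
                    (R : ∀ {n} → Graph n → Subset n → Set) → Set
PolyTimeAlgorithm P R =
  Σ[ C ∈ Command ] ∃[ c ] ∃[ d ]
    (∀ {n} (G : Graph n) → P G →
      ∃[ S ] ∃[ k ] (C ⊢ encodeGraph G ⇒ encodeSubset S [ k ]
                     × k ≤ c * n ^ d + c
                     × R G S))

-- The deterministic version of the property: the guarantee holds on every
-- H-free graph.  It is meant for ε′ < 1, where the exponent 1 - ε′ is positive.
ImprovedApproximation : ∀ {h} → Graph h → ℝ → Set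
ImprovedApproximation H ε′ =
  PolyTimeAlgorithm (H -Free_) λ {n} G I →
    IsIndependent G I × QuotientAtMost (α G) n (1ℝ -ℝ ε′) ∣ I ∣

{-# OPTIONS --safe #-}
module Submission where

-- Repeatedly remove from G the clique or independent set that the given
-- algorithm A finds among the remaining vertices, until none is left, and return
-- the largest independent set met (or a single vertex).  A removed clique meets an
-- independent set at most once, so α G is at most k times the size of the output,
-- k being the number of removed sets.  For a rational r = p / q < δ the sets
-- removed while at least 2 ^ i vertices are left have size at least 2 ^ (i r), and
-- summing over the dyadic scales i gives k = O(n ^ (1 - r) log n).  With r close to
-- δ this is at most n ^ (1 - δ + δ² + ε) for n ≥ n₀; for n < n₀ the program looks
-- up a maximum independent set in a finite table.

open import Defs
open import Data.Bool.Base using (Bool; true; false; not; _∧_)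
open import Data.Bool.Properties using (∧-comm; ∧-idem)
open import Data.Fin.Base using (Fin; zero; suc)
import Data.Fin.Properties as Fin
open import Data.Fin.Subset using (Subset; Empty; ∣_∣; _─_; _∈_; _∩_; ⊤; ⁅_⁆)
open import Data.Fin.Subset.Properties
  using (∣p∣≤n; ∣p∩q∣≤∣q∣; x∈p∩q⁻; Empty-unique; ∣⊥∣≡0; ∣⊤∣≡n; ∩-identityʳ; ∣⁅x⁆∣≡1)
import Data.Integer.Base as ℤ
import Data.Integer.Properties as ℤ
open import Data.Nat.Base
open import Data.Nat.DivMod
  using (m≡m%n+[m/n]*n; m%n<n; m/n*n≤m; m*n/n≡m; /-monoˡ-≤; m<n*o⇒m/o<n)
open import Data.Nat.Properties
open import Data.Nat.Solver using (module +-*-Solver)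
open import Data.Product.Base using (Σ-syntax; ∃-syntax; _×_; _,_; proj₁; proj₂)
open import Data.Rational.Base as ℚ using (ℚ; mkℚ; 0ℚ; 1ℚ; ½; toℚᵘ; fromℚᵘ)
import Data.Rational.Properties as ℚ
import Data.Rational.Solver as ℚ
import Data.Rational.Unnormalised.Base as ℚᵘ
import Data.Rational.Unnormalised.Properties as ℚᵘ
open import Data.Sum.Base using (_⊎_; inj₁; inj₂; map)
open import Data.Vec.Base using (Vec; []; _∷_; tabulate; lookup; here; there; replicate)
open import Data.Vec.Properties using (lookup∘tabulate; tabulate∘lookup)
open import Function.Base using (_∘_)
open import Function.Definitions using (Injective)
open import Relation.Binary.PropositionalEquality
open import Relation.Nullary.Decidable using (yes; no; does)
open import Relation.Nullary.Negation using (contradiction)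

-- Programs

-- The guarantee allows no constant factor and is asserted for every fraction `p′ / q′` above the
-- target exponent, so the threshold n₀ must not depend on that fraction. As δ is only a Cauchy
-- sequence, a rational `p / q` below δ and a natural number `N` are fixed with
-- `1 + 1 / N ≤ p′ / q′ + p / q` for all these fractions. The number of removed sets is about
-- `n ^ (1 - p / q)` times a logarithm; for large n the spare factor `n ^ (1 / N)` absorbs the
-- logarithm, the constants and all rounding, and what remains is integer arithmetic with powers of
-- two. Running A again on the remaining vertices is legitimate because being H-free passes to
-- induced subgraphs, and a single adjacency reveals which kind of set A has returned.

infix 4 _⊢_⇒_within_

_⊢_⇒_within_ : Command → Tree → Tree → ℕ → Set
C ⊢ s ⇒ t within b = ∃[ k ] (C ⊢ s ⇒ t [ k ] × k ≤ b)

relax : ∀ {C s t a b} → a ≤ b → C ⊢ s ⇒ t within a → C ⊢ s ⇒ t within b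
relax a≤b (k , run , k≤a) = k , run , ≤-trans k≤a a≤b

assigning : ∀ {s} E → X:= E ⊢ s ⇒ ⟦ E ⟧ s within 1 + cost E
assigning E = _ , assign , ≤-refl

infixr 5 _⨟_

_⨟_ : ∀ {C D s t u a b} → C ⊢ s ⇒ t within a → D ⊢ t ⇒ u within b →
  C ⨾ D ⊢ s ⇒ u within a + b
(_ , run , k≤a) ⨟ (_ , run′ , l≤b) = _ , sequence run run′ , +-mono-≤ k≤a l≤b

branching-true : ∀ {E C D s t a b k} → ⟦ E ⟧ s ≡ a ∙ b → C ⊢ s ⇒ t within k →
  if E then C else D ⊢ s ⇒ t within 1 + cost E + k
branching-true {E} eq (_ , run , k≤) = _ , if-true eq run , +-monoʳ-≤ (1 + cost E) k≤

branching-false : ∀ {E C D s t k} → ⟦ E ⟧ s ≡ nil → D ⊢ s ⇒ t within k →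
  if E then C else D ⊢ s ⇒ t within 1 + cost E + k
branching-false {E} eq (_ , run , k≤) = _ , if-false eq run , +-monoʳ-≤ (1 + cost E) k≤

-- Running a command on the top of a stack

onHeadᵉ : Expr → Expr
onHeadᵉ X          = hd X
onHeadᵉ nil        = nil
onHeadᵉ (cons E F) = cons (onHeadᵉ E) (onHeadᵉ F)
onHeadᵉ (hd E)     = hd (onHeadᵉ E)
onHeadᵉ (tl E)     = tl (onHeadᵉ E)

-- The only variable X has to hold a stack; onHead C runs C on its top.
onHead : Command → Command
onHead (X:= E)               = X:= cons (onHeadᵉ E) (tl X)
onHead (C ⨾ D)               = onHead C ⨾ onHead D
onHead (if E then C else D)  = if onHeadᵉ E then onHead C else onHead D
onHead (while E loop C)      = while onHeadᵉ E loop onHead C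

⟦onHeadᵉ⟧ : ∀ E {s r} → ⟦ onHeadᵉ E ⟧ (s ∙ r) ≡ ⟦ E ⟧ s
⟦onHeadᵉ⟧ X          = refl
⟦onHeadᵉ⟧ nil        = refl
⟦onHeadᵉ⟧ (cons E F) = cong₂ _∙_ (⟦onHeadᵉ⟧ E) (⟦onHeadᵉ⟧ F)
⟦onHeadᵉ⟧ (hd E)     = cong head (⟦onHeadᵉ⟧ E)
⟦onHeadᵉ⟧ (tl E)     = cong tail (⟦onHeadᵉ⟧ E)

private
  double-suc : ∀ {m n} → m ≤ 2 * n → 1 + m ≤ 2 * (1 + n)
  double-suc {m} {n} m≤2n = begin
    1 + m        ≤⟨ s≤s m≤2n ⟩
    1 + 2 * n    ≤⟨ n≤1+n _ ⟩
    2 + 2 * n    ≡⟨ *-suc 2 n ⟨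
    2 * (1 + n)  ∎
    where open ≤-Reasoning

cost-onHeadᵉ : ∀ E → cost (onHeadᵉ E) ≤ 2 * cost E
cost-onHeadᵉ X          = ≤-refl
cost-onHeadᵉ nil        = s≤s z≤n
cost-onHeadᵉ (cons E F) = double-suc (begin
  cost (onHeadᵉ E) + cost (onHeadᵉ F)  ≤⟨ +-mono-≤ (cost-onHeadᵉ E) (cost-onHeadᵉ F) ⟩
  2 * cost E + 2 * cost F              ≡⟨ *-distribˡ-+ 2 (cost E) (cost F) ⟨
  2 * (cost E + cost F)                ∎)
  where open ≤-Reasoning
cost-onHeadᵉ (hd E)     = double-suc (cost-onHeadᵉ E)
cost-onHeadᵉ (tl E)     = double-suc (cost-onHeadᵉ E)

private
  2≤4 : 2 ≤ 4
  2≤4 = s≤s (s≤s z≤n)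

  test-bound : ∀ E → 1 + cost (onHeadᵉ E) ≤ 4 * (1 + cost E)
  test-bound E = ≤-trans (double-suc (cost-onHeadᵉ E)) (*-monoˡ-≤ (1 + cost E) 2≤4)

  assign-bound : ∀ E → 1 + cost (cons (onHeadᵉ E) (tl X)) ≤ 4 * (1 + cost E)
  assign-bound E = begin
    2 + (cost (onHeadᵉ E) + 2)  ≤⟨ +-monoʳ-≤ 2 (+-monoˡ-≤ 2 (cost-onHeadᵉ E)) ⟩
    2 + (2 * cost E + 2)        ≤⟨ +-monoʳ-≤ 2 (+-monoˡ-≤ 2 (*-monoˡ-≤ (cost E) 2≤4)) ⟩
    2 + (4 * cost E + 2)        ≡⟨ solve 1 (λ c → con 2 :+ (con 4 :* c :+ con 2) := con 4 :* (con 1 :+ c)) refl (cost E) ⟩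
    4 * (1 + cost E)            ∎
    where open ≤-Reasoning
          open +-*-Solver

  sum-bound : ∀ {a b} k l → a ≤ 4 * k → b ≤ 4 * l → a + b ≤ 4 * (k + l)
  sum-bound k l a≤ b≤ = ≤-trans (+-mono-≤ a≤ b≤) (≤-reflexive (sym (*-distribˡ-+ 4 k l)))

-- Reading `hd X` for `X` at most doubles the cost of an expression, and an assignment pays 3 more
-- for putting the rest of the stack back: an assignment of cost `1 + c` becomes one of at most
-- `4 + 2 * c`, whence the factor 4. A constant factor is what keeps a call of A in every round
-- polynomial.
onHead-run : ∀ {C s t k r} → C ⊢ s ⇒ t [ k ] → onHead C ⊢ s ∙ r ⇒ t ∙ r within 4 * k
onHead-run {s = s} {r = r} (assign {E}) =
  _ , subst (λ t → _ ⊢ s ∙ r ⇒ t ∙ r [ _ ]) (⟦onHeadᵉ⟧ E) assign , assign-bound E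
onHead-run (sequence {k = k} {l} run run′) =
  let _ , lifted , k≤ = onHead-run run; _ , lifted′ , l≤ = onHead-run run′
  in _ , sequence lifted lifted′ , sum-bound k l k≤ l≤
onHead-run (if-true {E} {k = k} eq run) =
  let _ , lifted , k≤ = onHead-run run
  in _ , if-true (trans (⟦onHeadᵉ⟧ E) eq) lifted , sum-bound (1 + cost E) k (test-bound E) k≤
onHead-run (if-false {E} {k = k} eq run) =
  let _ , lifted , k≤ = onHead-run run
  in _ , if-false (trans (⟦onHeadᵉ⟧ E) eq) lifted , sum-bound (1 + cost E) k (test-bound E) k≤
onHead-run (while-true {E} {k = k} {l} eq run run′) =
  let _ , lifted , k≤ = onHead-run run; _ , lifted′ , l≤ = onHead-run run′
  in _ , while-true (trans (⟦onHeadᵉ⟧ E) eq) lifted lifted′ ,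
     sum-bound (1 + cost E + k) l (sum-bound (1 + cost E) k (test-bound E) k≤) l≤
onHead-run (while-false {E} eq) = _ , while-false (trans (⟦onHeadᵉ⟧ E) eq) , test-bound E

onHead-within : ∀ {C s t b r} → C ⊢ s ⇒ t within b → onHead C ⊢ s ∙ r ⇒ t ∙ r within 4 * b
onHead-within (_ , run , k≤b) = relax (*-monoʳ-≤ 4 k≤b) (onHead-run run)

opaque
  push : Expr → Command → Command
  push E C = X:= cons E X ⨾ onHead C

  pushTime : Expr → ℕ → ℕ
  pushTime E b = 1 + cost (cons E X) + 4 * b

  pushing : ∀ C {s t b} E → C ⊢ ⟦ E ⟧ s ⇒ t within b → push E C ⊢ s ⇒ t ∙ s within pushTime E b
  pushing _ E run = assigning (cons E X) ⨟ onHead-within run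

opaque
  -- Started with X = L ∙ s, the loop replaces s by the result of C on x ∙ s, for
  -- each x in the list L.
  forEach : Command → Command
  forEach C = while hd X loop
    (X:= cons (cons (hd (hd X)) (tl X)) (tl (hd X)) ⨾ onHead C ⨾ X:= cons (tl X) (hd X))

  roundTime : ℕ → ℕ
  roundTime b = 20 + 4 * b

  forEach-cons : ∀ C {x L s t u a b} → C ⊢ x ∙ s ⇒ t within a →
    forEach C ⊢ L ∙ t ⇒ u within b → forEach C ⊢ (x ∙ L) ∙ s ⇒ u within roundTime a + b
  forEach-cons _ {a = a} {b} body (_ , rest , l≤b) =
    let _ , run , k≤ = assigning (cons (cons (hd (hd X)) (tl X)) (tl (hd X))) ⨟
                       onHead-within body ⨟ assigning (cons (tl X) (hd X))
    in _ , while-true refl run rest ,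
       +-mono-≤ (≤-trans (+-monoʳ-≤ 3 k≤) (≤-reflexive (shuffle a))) l≤b
    where
    open +-*-Solver
    shuffle : ∀ a → 3 + (11 + (4 * a + 6)) ≡ roundTime a
    shuffle = solve 1 (λ a → con 3 :+ (con 11 :+ (con 4 :* a :+ con 6)) := con 20 :+ con 4 :* a) refl

  loopTime : ℕ → ℕ → ℕ
  loopTime b n = n * roundTime b + 3

  forEach-nil : ∀ C {s b} → forEach C ⊢ nil ∙ s ⇒ nil ∙ s within loopTime b 0
  forEach-nil _ = _ , while-false refl , ≤-refl

  loopTime-monoʳ : ∀ b {m n} → m ≤ n → loopTime b m ≤ loopTime b n
  loopTime-monoʳ b m≤n = +-monoˡ-≤ 3 (*-monoˡ-≤ (roundTime b) m≤n)

  forEach-suc : ∀ C {x L s t u b} n → C ⊢ x ∙ s ⇒ t within b →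
    forEach C ⊢ L ∙ t ⇒ u within loopTime b n →
    forEach C ⊢ (x ∙ L) ∙ s ⇒ u within loopTime b (suc n)
  forEach-suc _ {b = b} n body rest =
    relax (≤-reflexive (sym (+-assoc (roundTime b) (n * roundTime b) 3))) (forEach-cons _ body rest)

-- List reversal and transducers

revOnto : Tree → Tree → Tree
revOnto nil     u = u
revOnto (x ∙ t) u = revOnto t (x ∙ u)

revOnto-revOnto : ∀ t u → revOnto (revOnto t u) nil ≡ revOnto u t
revOnto-revOnto nil     u = refl
revOnto-revOnto (x ∙ t) u = revOnto-revOnto t (x ∙ u)

len : Tree → ℕ
len nil     = 0
len (x ∙ t) = suc (len t)

len-revOnto : ∀ t u → len (revOnto t u) ≡ len t + len u
len-revOnto nil     u = refl
len-revOnto (x ∙ t) u = trans (len-revOnto t (x ∙ u)) (+-suc (len t) (len u))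

len-encodeVec : ∀ {a} {A : Set a} {n} (e : A → Tree) (xs : Vec A n) → len (encodeVec e xs) ≡ n
len-encodeVec e []       = refl
len-encodeVec e (x ∷ xs) = cong suc (len-encodeVec e xs)

-- The loop hands `x ∙ u` to its body and takes the result as the new state, so the identity body
-- already moves `x` onto the accumulator.
reversing : ∀ t u → forEach (X:= X) ⊢ t ∙ u ⇒ nil ∙ revOnto t u within loopTime 2 (len t)
reversing nil     u = forEach-nil (X:= X)
reversing (x ∙ t) u = forEach-suc (X:= X) (len t) (assigning X) (reversing t (x ∙ u))

opaque
  -- C emits the output list in reverse order, onto the accumulator in the last
  -- component of the loop state.
  transduce : Command → Command
  transduce C =
    X:= cons (hd X) (cons (tl X) nil) ⨾ forEach C ⨾
    X:= cons (tl (tl X)) nil ⨾ forEach (X:= X) ⨾ X:= tl X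

  transduceTime : ℕ → ℕ → ℕ
  transduceTime b n = 8 + (b + (6 + (loopTime 2 n + 3)))

  transducing : ∀ C {L s z t b n} → forEach C ⊢ L ∙ (s ∙ nil) ⇒ nil ∙ (z ∙ revOnto t nil) within b →
    len t ≤ n → transduce C ⊢ L ∙ s ⇒ t within transduceTime b n
  transducing _ {t = t} {n = n} emitting len≤n =
    assigning (cons (hd X) (cons (tl X) nil)) ⨟ emitting ⨟ assigning (cons (tl (tl X)) nil) ⨟
    relax (loopTime-monoʳ 2 len′≤n)
      (subst (λ u → forEach (X:= X) ⊢ revOnto t nil ∙ nil ⇒ nil ∙ u within loopTime 2 (len (revOnto t nil)))
        (revOnto-revOnto t nil) (reversing (revOnto t nil) nil)) ⨟
    assigning (tl X)
    where
    len′≤n : len (revOnto t nil) ≤ n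
    len′≤n = subst (_≤ n) (sym (trans (len-revOnto t nil) (+-identityʳ (len t)))) len≤n

-- Sets of vertices

-- The increasing enumeration of `M`. With it a filtered tabulation is again a tabulation, of
-- `f ∘ nth M`, and the extracted submatrix is by definition the encoding of `induce G M`.
nth : ∀ {n} (M : Subset n) → Fin ∣ M ∣ → Fin n
nth (true  ∷ M) zero    = zero
nth (true  ∷ M) (suc i) = suc (nth M i)
nth (false ∷ M) i       = suc (nth M i)

len-tabulate : ∀ {n} {A : Set} (e : A → Tree) (M : Subset n) (f : Fin ∣ M ∣ → A) →
  len (encodeVec e (tabulate f)) ≤ n
len-tabulate e M f = ≤-trans (≤-reflexive (len-encodeVec e (tabulate f))) (∣p∣≤n M)

filterStep : Command
filterStep = if hd X
  then X:= cons (tl (hd (tl X))) (cons (hd (hd (tl X))) (tl (tl X)))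
  else X:= cons (tl (hd (tl X))) (tl (tl X))

filterLoop : ∀ {n} {A : Set} (e : A → Tree) (M : Subset n) (f : Fin n → A) acc →
  forEach filterStep ⊢ encodeSubset M ∙ (encodeVec e (tabulate f) ∙ acc)
    ⇒ nil ∙ (nil ∙ revOnto (encodeVec e (tabulate (f ∘ nth M))) acc) within loopTime 17 n
filterLoop e []          f acc = forEach-nil filterStep
filterLoop e (true ∷ M)  f acc = forEach-suc filterStep _
  (branching-true refl (assigning (cons (tl (hd (tl X))) (cons (hd (hd (tl X))) (tl (tl X))))))
  (filterLoop e M (f ∘ suc) (e (f zero) ∙ acc))
filterLoop e (false ∷ M) f acc = forEach-suc filterStep _
  (relax (m≤m+n 12 5) (branching-false refl (assigning (cons (tl (hd (tl X))) (tl (tl X))))))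
  (filterLoop e M (f ∘ suc) acc)

filterProgram : Command
filterProgram = transduce filterStep

filterTime : ℕ → ℕ
filterTime n = transduceTime (loopTime 17 n) n

filtering : ∀ {n} {A : Set} (e : A → Tree) (M : Subset n) (f : Fin n → A) →
  filterProgram ⊢ encodeSubset M ∙ encodeVec e (tabulate f) ⇒ encodeVec e (tabulate (f ∘ nth M))
    within filterTime n
filtering e M f = transducing filterStep (filterLoop e M f nil) (len-tabulate e M (f ∘ nth M))

-- Input M ∙ N ∙ rows; the loop state is (N ∙ rows) ∙ acc.
submatrixStep : Command
submatrixStep = if hd X
  then push (cons (hd (hd (tl X))) (hd (tl (hd (tl X))))) filterProgram ⨾
       X:= cons (cons (hd (hd (tl (tl X)))) (tl (tl (hd (tl (tl X))))))
                (cons (hd X) (tl (tl (tl X))))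
  else X:= cons (cons (hd (hd (tl X))) (tl (tl (hd (tl X))))) (tl (tl X))

submatrixStepTime : ℕ → ℕ
submatrixStepTime n = 3 + (pushTime (cons (hd (hd (tl X))) (hd (tl (hd (tl X))))) (filterTime n) + 21)

encodeMatrix : ∀ {m n} → (Fin m → Fin n → Bool) → Tree
encodeMatrix F = encodeVec (encodeVec encodeBool) (tabulate λ i → tabulate (F i))

-- Rows and columns get separate sets because the induction consumes `M` row by row while each kept
-- row is filtered by the whole of `N`.
submatrixLoop : ∀ {m n} (M : Subset m) (N : Subset n) (F : Fin m → Fin n → Bool) acc →
  forEach submatrixStep ⊢ encodeSubset M ∙ ((encodeSubset N ∙ encodeMatrix F) ∙ acc)
    ⇒ nil ∙ ((encodeSubset N ∙ nil) ∙ revOnto (encodeMatrix λ i j → F (nth M i) (nth N j)) acc)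
    within loopTime (submatrixStepTime n) m
submatrixLoop []          N F acc = forEach-nil submatrixStep
submatrixLoop (true ∷ M)  N F acc = forEach-suc submatrixStep _
  (branching-true refl
    (pushing filterProgram (cons (hd (hd (tl X))) (hd (tl (hd (tl X))))) (filtering encodeBool N (F zero)) ⨟
     assigning (cons (cons (hd (hd (tl (tl X)))) (tl (tl (hd (tl (tl X))))))
                     (cons (hd X) (tl (tl (tl X)))))))
  (submatrixLoop M N (F ∘ suc) _)
submatrixLoop (false ∷ M) N F acc = forEach-suc submatrixStep _
  (branching-false refl
    (relax (≤-trans (m≤m+n _ 6) (m≤n+m 21 _))
      (assigning (cons (cons (hd (hd (tl X))) (tl (tl (hd (tl X))))) (tl (tl X))))))
  (submatrixLoop M N (F ∘ suc) acc)

submatrixProgram : Command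
submatrixProgram = transduce submatrixStep

submatrixTime : ℕ → ℕ
submatrixTime n = transduceTime (loopTime (submatrixStepTime n) n) n

extracting : ∀ {n} (M : Subset n) (F : Fin n → Fin n → Bool) →
  submatrixProgram ⊢ encodeSubset M ∙ (encodeSubset M ∙ encodeMatrix F)
    ⇒ encodeMatrix (λ i j → F (nth M i) (nth M j)) within submatrixTime n
extracting M F = transducing submatrixStep (submatrixLoop M M F nil) (len-tabulate _ M _)

expand : ∀ {n} (M : Subset n) → Subset ∣ M ∣ → Subset n
expand []          S       = []
expand (true ∷ M)  (b ∷ S) = b ∷ expand M S
expand (false ∷ M) S       = false ∷ expand M S

expandStep : Command
expandStep = if hd X
  then X:= cons (tl (hd (tl X))) (cons (hd (hd (tl X))) (tl (tl X)))
  else X:= cons (hd (tl X)) (cons nil (tl (tl X)))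

expandLoop : ∀ {n} (M : Subset n) (S : Subset ∣ M ∣) acc →
  forEach expandStep ⊢ encodeSubset M ∙ (encodeSubset S ∙ acc)
    ⇒ nil ∙ (nil ∙ revOnto (encodeSubset (expand M S)) acc) within loopTime 17 n
expandLoop []          []      acc = forEach-nil expandStep
expandLoop (true ∷ M)  (b ∷ S) acc = forEach-suc expandStep _
  (branching-true refl (assigning (cons (tl (hd (tl X))) (cons (hd (hd (tl X))) (tl (tl X))))))
  (expandLoop M S (encodeBool b ∙ acc))
expandLoop (false ∷ M) S       acc = forEach-suc expandStep _
  (relax (m≤m+n 13 4) (branching-false refl (assigning (cons (hd (tl X)) (cons nil (tl (tl X)))))))
  (expandLoop M S (nil ∙ acc))

expandProgram : Command
expandProgram = transduce expandStep

expanding : ∀ {n} (M : Subset n) (S : Subset ∣ M ∣) →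
  expandProgram ⊢ encodeSubset M ∙ encodeSubset S ⇒ encodeSubset (expand M S) within filterTime n
expanding M S = transducing expandStep (expandLoop M S nil)
  (≤-reflexive (len-encodeVec encodeBool (expand M S)))

differenceStep : Command
differenceStep = if hd (hd (tl X))
  then X:= cons (tl (hd (tl X))) (cons nil (tl (tl X)))
  else X:= cons (tl (hd (tl X))) (cons (hd X) (tl (tl X)))

differenceLoop : ∀ {n} (M S : Subset n) acc →
  forEach differenceStep ⊢ encodeSubset M ∙ (encodeSubset S ∙ acc)
    ⇒ nil ∙ (nil ∙ revOnto (encodeSubset (M ─ S)) acc) within loopTime 17 n
differenceLoop []      []          acc = forEach-nil differenceStep
differenceLoop (b ∷ M) (true ∷ S)  acc = forEach-suc differenceStep _
  (relax (m≤m+n 16 1) (branching-true refl (assigning (cons (tl (hd (tl X))) (cons nil (tl (tl X)))))))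
  (differenceLoop M S (nil ∙ acc))
differenceLoop (b ∷ M) (false ∷ S) acc = forEach-suc differenceStep _
  (branching-false refl (assigning (cons (tl (hd (tl X))) (cons (hd X) (tl (tl X))))))
  (differenceLoop M S (encodeBool b ∙ acc))

differenceProgram : Command
differenceProgram = transduce differenceStep

subtracting : ∀ {n} (M S : Subset n) →
  differenceProgram ⊢ encodeSubset M ∙ encodeSubset S ⇒ encodeSubset (M ─ S) within filterTime n
subtracting M S = transducing differenceStep (differenceLoop M S nil)
  (≤-reflexive (len-encodeVec encodeBool (M ─ S)))

compareStep : Command
compareStep = X:= tl (tl X)

-- Sizes in unary: each item of `L` pops one item of `t`, and `tail nil = nil` makes the subtraction
-- truncated. The rest `u` is non-nil exactly when `t` is the longer list.
comparing : ∀ L t → ∃[ u ] (len u ≡ len t ∸ len L ×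
  forEach compareStep ⊢ L ∙ t ⇒ nil ∙ u within loopTime 4 (len L))
comparing nil     t       = t , refl , forEach-nil compareStep
comparing (x ∙ L) nil     =
  let u , lenu , run = comparing L nil
  in u , trans lenu (0∸n≡0 (len L)) , forEach-suc compareStep _ (assigning (tl (tl X))) run
comparing (x ∙ L) (y ∙ t) =
  let u , lenu , run = comparing L t
  in u , lenu , forEach-suc compareStep _ (assigning (tl (tl X))) run

-- Induced subgraphs

nth-injective : ∀ {n} (M : Subset n) → Injective _≡_ _≡_ (nth M)
nth-injective (true  ∷ M) {zero}  {zero}  eq = refl
nth-injective (true  ∷ M) {suc i} {suc j} eq = cong suc (nth-injective M (Fin.suc-injective eq))
nth-injective (false ∷ M)                 eq = nth-injective M (Fin.suc-injective eq)

nth∈ : ∀ {n} (M : Subset n) i → nth M i ∈ M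
nth∈ (true  ∷ M) zero    = here
nth∈ (true  ∷ M) (suc i) = there (nth∈ M i)
nth∈ (false ∷ M) i       = there (nth∈ M i)

∈-expand : ∀ {n} (M : Subset n) S {i} → i ∈ expand M S → ∃[ j ] (j ∈ S × nth M j ≡ i)
∈-expand (true ∷ M)  (b ∷ S) here       = zero , here , refl
∈-expand (true ∷ M)  (b ∷ S) (there i∈) =
  let j , j∈ , eq = ∈-expand M S i∈ in suc j , there j∈ , cong suc eq
∈-expand (false ∷ M) S       (there i∈) =
  let j , j∈ , eq = ∈-expand M S i∈ in j , j∈ , cong suc eq

∣expand∣ : ∀ {n} (M : Subset n) S → ∣ expand M S ∣ ≡ ∣ S ∣
∣expand∣ []          []          = refl
∣expand∣ (true ∷ M)  (true ∷ S)  = cong suc (∣expand∣ M S)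
∣expand∣ (true ∷ M)  (false ∷ S) = ∣expand∣ M S
∣expand∣ (false ∷ M) S           = ∣expand∣ M S

∣─expand∣ : ∀ {n} (M : Subset n) S → ∣ M ─ expand M S ∣ + ∣ S ∣ ≡ ∣ M ∣
∣─expand∣ []          []          = refl
∣─expand∣ (true ∷ M)  (true ∷ S)  = trans (+-suc _ ∣ S ∣) (cong suc (∣─expand∣ M S))
∣─expand∣ (true ∷ M)  (false ∷ S) = cong suc (∣─expand∣ M S)
∣─expand∣ (false ∷ M) S           = ∣─expand∣ M S

∣∩∣-split : ∀ {n} (T M S : Subset n) → ∣ T ∩ M ∣ ≤ ∣ T ∩ (M ─ S) ∣ + ∣ T ∩ S ∣
∣∩∣-split []          []          []          = z≤n
∣∩∣-split (false ∷ T) (b ∷ M)     (c ∷ S)     = ∣∩∣-split T M S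
∣∩∣-split (true ∷ T)  (true ∷ M)  (true ∷ S)  =
  ≤-trans (s≤s (∣∩∣-split T M S)) (≤-reflexive (sym (+-suc _ _)))
∣∩∣-split (true ∷ T)  (true ∷ M)  (false ∷ S) = s≤s (∣∩∣-split T M S)
∣∩∣-split (true ∷ T)  (false ∷ M) (true ∷ S)  =
  ≤-trans (∣∩∣-split T M S) (+-monoʳ-≤ _ (n≤1+n _))
∣∩∣-split (true ∷ T)  (false ∷ M) (false ∷ S) = ∣∩∣-split T M S

∣∣≤1 : ∀ {n} (P : Subset n) → (∀ i j → i ∈ P → j ∈ P → i ≡ j) → ∣ P ∣ ≤ 1
∣∣≤1 []           same = z≤n
∣∣≤1 {suc n} (true ∷ P) same = s≤s (≤-reflexive (trans (cong ∣_∣ (Empty-unique empty)) (∣⊥∣≡0 n)))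
  where
  empty : Empty P
  empty (i , i∈) = Fin.0≢1+n (same zero (suc i) here (there i∈))
∣∣≤1 (false ∷ P)  same = ∣∣≤1 P (λ i j i∈ j∈ → Fin.suc-injective (same (suc i) (suc j) (there i∈) (there j∈)))

clique∩independent : ∀ {n} (G : Graph n) T S → IsIndependent G T → IsClique G S → ∣ T ∩ S ∣ ≤ 1
clique∩independent G T S independent clique = ∣∣≤1 (T ∩ S) same
  where
  same : ∀ i j → i ∈ T ∩ S → j ∈ T ∩ S → i ≡ j
  same i j i∈ j∈ with i Fin.≟ j
  ... | yes i≡j = i≡j
  ... | no  i≢j =
    let i∈T , i∈S = x∈p∩q⁻ T S i∈; j∈T , j∈S = x∈p∩q⁻ T S j∈
    in contradiction (trans (sym (independent i j i∈T j∈T)) (clique i j i∈S j∈S i≢j)) λ ()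

induce : ∀ {n} → Graph n → (M : Subset n) → Graph ∣ M ∣
induce G M .adj i j       = adj G (nth M i) (nth M j)
induce G M .symmetric i j = symmetric G (nth M i) (nth M j)
induce G M .irreflexive i = irreflexive G (nth M i)

induce-free : ∀ {h n} (H : Graph h) (G : Graph n) M → H -Free G → H -Free induce G M
induce-free H G M free copy = free record
  { embed     = nth M ∘ embed
  ; injective = injective ∘ nth-injective M
  ; preserves = preserves
  } where open InducedSubgraph copy

expand-clique : ∀ {n} (G : Graph n) M S → IsClique (induce G M) S → IsClique G (expand M S)
expand-clique G M S clique i j i∈ j∈ i≢j with ∈-expand M S i∈ | ∈-expand M S j∈
... | k , k∈ , refl | l , l∈ , refl = clique k l k∈ l∈ (i≢j ∘ cong (nth M))

expand-independent : ∀ {n} (G : Graph n) M S →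
  IsIndependent (induce G M) S → IsIndependent G (expand M S)
expand-independent G M S independent i j i∈ j∈ with ∈-expand M S i∈ | ∈-expand M S j∈
... | k , k∈ , refl | l , l∈ , refl = independent k l k∈ l∈

∈⇒nth : ∀ {n} (M : Subset n) {i} → i ∈ M → ∃[ k ] nth M k ≡ i
∈⇒nth (true ∷ M)  here       = zero , refl
∈⇒nth (true ∷ M)  (there i∈) = let k , eq = ∈⇒nth M i∈ in suc k , cong suc eq
∈⇒nth (false ∷ M) (there i∈) = let k , eq = ∈⇒nth M i∈ in k , cong suc eq

Fin≤1-unique : ∀ {m} → m ≤ 1 → (i j : Fin m) → i ≡ j
Fin≤1-unique (s≤s z≤n) zero zero = refl

∣∣≤1⇒independent : ∀ {n} (G : Graph n) S → ∣ S ∣ ≤ 1 → IsIndependent G S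
∣∣≤1⇒independent G S ∣S∣≤1 i j i∈ j∈ with ∈⇒nth S i∈ | ∈⇒nth S j∈
... | k , refl | l , refl rewrite Fin≤1-unique ∣S∣≤1 k l = irreflexive G (nth S l)

-- The entry in row 0 and column 1. On a matrix with at most one row the defaults of `head` and
-- `tail` yield `nil`, which reads as independent, and rightly so for at most one vertex.
firstEntry : Tree → Tree
firstEntry t = head (tail (head t))

firstEntry-matrix : ∀ {m} (F : Fin m → Fin m → Bool) →
  m ≤ 1 × firstEntry (encodeMatrix F) ≡ nil ⊎
  ∃[ i ] ∃[ j ] (i ≢ j × firstEntry (encodeMatrix F) ≡ encodeBool (F i j))
firstEntry-matrix {zero}        F = inj₁ (z≤n , refl)
firstEntry-matrix {suc zero}    F = inj₁ (s≤s z≤n , refl)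
firstEntry-matrix {suc (suc m)} F = inj₂ (zero , suc zero , (λ ()) , refl)

-- The first two vertices tell a clique from an independent set.
clique-or-independent : ∀ {n} (G : Graph n) (S : Subset n) → IsClique G S ⊎ IsIndependent G S →
  firstEntry (encodeGraph (induce G S)) ≡ nil × IsIndependent G S ⊎
  firstEntry (encodeGraph (induce G S)) ≡ nil ∙ nil × IsClique G S
clique-or-independent G S homogeneous with firstEntry-matrix (adj (induce G S))
... | inj₁ (∣S∣≤1 , entry) = inj₁ (entry , ∣∣≤1⇒independent G S ∣S∣≤1)
... | inj₂ (i , j , i≢j , entry) with adj G (nth S i) (nth S j) in eq | homogeneous
...   | true  | inj₁ clique      = inj₂ (entry , clique)
...   | true  | inj₂ independent =
        contradiction (trans (sym eq) (independent _ _ (nth∈ S i) (nth∈ S j))) λ ()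
...   | false | inj₁ clique      =
        contradiction (trans (sym eq) (clique _ _ (nth∈ S i) (nth∈ S j) (i≢j ∘ nth-injective S))) λ ()
...   | false | inj₂ independent = inj₁ (entry , independent)

-- One round of peeling

drop : ℕ → Expr
drop zero    = X
drop (suc i) = tl (drop i)

item : ℕ → Expr
item i = hd (drop i)

-- `item 1` is what the comparing loop leaves, `nil` paired with the unary difference of the sizes
-- of `B` and `S′`. A non-nil difference means that `B` is strictly larger; otherwise the first
-- entry of the matrix in `item 4` decides, and `S′` replaces `B` only if it is independent.
choose : Command
choose = if tl (item 1)
  then X:= cons (item 7) (cons (item 0) (drop 9))
  else if hd (tl (hd (item 4)))
    then X:= cons (item 7) (cons (item 0) (drop 9))
    else X:= cons (item 7) (cons (item 0) (item 5))

choose-old : ∀ {D c u V U H S′ S G M B} → (∃[ x ] ∃[ y ] u ≡ x ∙ y) ⊎ (∃[ x ] ∃[ y ] firstEntry H ≡ x ∙ y) →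
  choose ⊢ D ∙ (c ∙ u) ∙ V ∙ U ∙ H ∙ S′ ∙ S ∙ G ∙ M ∙ B ⇒ G ∙ D ∙ B within 39
choose-old {u = u} _ with u in eq
choose-old _ | x ∙ y =
  relax (m≤m+n 29 10) (branching-true refl (assigning (cons (item 7) (cons (item 0) (drop 9)))))
choose-old (inj₂ (_ , _ , eq)) | nil =
  branching-false refl (branching-true eq (assigning (cons (item 7) (cons (item 0) (drop 9)))))

choose-new : ∀ {D c V U H S′ S G M B} → firstEntry H ≡ nil →
  choose ⊢ D ∙ (c ∙ nil) ∙ V ∙ U ∙ H ∙ S′ ∙ S ∙ G ∙ M ∙ B ⇒ G ∙ D ∙ S′ within 39
choose-new eq = relax (m≤m+n 36 3) (branching-false refl (branching-false eq
  (assigning (cons (item 7) (cons (item 0) (item 5))))))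

-- One round of peeling turns  row ∙ G ∙ M ∙ B  into  G ∙ M′ ∙ B′, where M is the
-- set of the remaining vertices and B the best independent set so far.  Before
-- the final choice the stack is
--   M ─ S′ ∙ comparison ∙ ∣ B ∣ ∙ ∣ S′ ∣ ∙ G[S′] ∙ S′ ∙ S ∙ G ∙ M ∙ B
-- with the sizes in unary, S the output of A on G[M] and S′ the set S as a set of
-- vertices of G.
round : Command → Command
round A =
  X:= tl X ⨾
  push (cons (item 1) (cons (item 1) (item 0))) submatrixProgram ⨾
  onHead A ⨾
  push (cons (item 2) (item 0)) expandProgram ⨾
  push (cons (item 0) (cons (item 0) (item 2))) submatrixProgram ⨾
  push (cons (item 1) (item 1)) filterProgram ⨾
  push (cons (drop 6) (drop 6)) filterProgram ⨾
  push (cons (item 1) (item 0)) (forEach compareStep) ⨾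
  push (cons (item 7) (item 4)) differenceProgram ⨾
  choose

roundRunTime : ℕ → ℕ → ℕ
roundRunTime n a =
  3 + (pushTime (cons (item 1) (cons (item 1) (item 0))) (submatrixTime n) +
  (4 * a +
  (pushTime (cons (item 2) (item 0)) (filterTime n) +
  (pushTime (cons (item 0) (cons (item 0) (item 2))) (submatrixTime n) +
  (pushTime (cons (item 1) (item 1)) (filterTime n) +
  (pushTime (cons (drop 6) (drop 6)) (filterTime n) +
  (pushTime (cons (item 1) (item 0)) (loopTime 4 n) +
  (pushTime (cons (item 7) (item 4)) (filterTime n) +
  39))))))))

encodeState : ∀ {n} → Graph n → Subset n → Subset n → Tree
encodeState G M B = encodeGraph G ∙ (encodeSubset M ∙ encodeSubset B)

-- Filtering a characteristic vector by itself keeps just its true entries, a unary numeral for the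
-- size.
shrinking : ∀ {n} (S : Subset n) →
  ∃[ t ] (len t ≡ ∣ S ∣ × filterProgram ⊢ encodeSubset S ∙ encodeSubset S ⇒ t within filterTime n)
shrinking {n} S =
  _ , len-encodeVec encodeBool (tabulate (lookup S ∘ nth S)) ,
  subst (λ U → filterProgram ⊢ encodeSubset S ∙ encodeSubset U
                 ⇒ encodeVec encodeBool (tabulate (lookup S ∘ nth S)) within filterTime n)
    (tabulate∘lookup S) (filtering encodeBool S (lookup S))

module _ {n : ℕ} {A : Command} {a : ℕ} (G : Graph n) (M B : Subset n) (S : Subset ∣ M ∣) {row : Tree}
  (oracle : A ⊢ encodeGraph (induce G M) ⇒ encodeSubset S within a)
  (homogeneous : IsClique (induce G M) S ⊎ IsIndependent (induce G M) S)
  (B-independent : IsIndependent G B) (1≤∣B∣ : 1 ≤ ∣ B ∣) where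

  private
    S′ = expand M S

  -- A clique `S′` meets an independent `T` in at most one vertex, hence in at most `∣ B ∣`, which
  -- is why a nonempty `B` is carried along. An independent `S′` either becomes the new best set or
  -- is smaller than the old one.
  round-run :
    ∃[ B′ ] (IsIndependent G B′ × ∣ B ∣ ≤ ∣ B′ ∣ ×
      (∀ T → IsIndependent G T → ∣ T ∩ S′ ∣ ≤ ∣ B′ ∣) ×
      round A ⊢ row ∙ encodeState G M B ⇒ encodeState G (M ─ S′) B′ within roundRunTime n a)
  round-run with shrinking S′ | shrinking B
  ... | U , lenU , shrinkS | V , lenV , shrinkB with comparing U V
  ... | W , lenW , compare = result W refl (clique-or-independent G S′ homogeneous′)
    where
    lenW′ : len W ≡ ∣ B ∣ ∸ ∣ S′ ∣
    lenW′ = trans lenW (cong₂ _∸_ lenV lenU)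

    run : ∀ {t} → choose ⊢ encodeSubset (M ─ S′) ∙ (nil ∙ W) ∙ V ∙ U ∙ encodeGraph (induce G S′) ∙
                           encodeSubset S′ ∙ encodeSubset S ∙ encodeState G M B ⇒ t within 39 →
          round A ⊢ row ∙ encodeState G M B ⇒ t within roundRunTime n a
    run choice =
      assigning (tl X) ⨟
      pushing submatrixProgram (cons (item 1) (cons (item 1) (item 0))) (extracting M (adj G)) ⨟
      onHead-within oracle ⨟
      pushing expandProgram (cons (item 2) (item 0)) (expanding M S) ⨟
      pushing submatrixProgram (cons (item 0) (cons (item 0) (item 2))) (extracting S′ (adj G)) ⨟
      pushing filterProgram (cons (item 1) (item 1)) shrinkS ⨟
      pushing filterProgram (cons (drop 6) (drop 6)) shrinkB ⨟
      pushing (forEach compareStep) (cons (item 1) (item 0))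
        (relax (loopTime-monoʳ 4 (subst (_≤ n) (sym lenU) (∣p∣≤n S′))) compare) ⨟
      pushing differenceProgram (cons (item 7) (item 4)) (subtracting M S′) ⨟
      choice

    homogeneous′ : IsClique G S′ ⊎ IsIndependent G S′
    homogeneous′ = map (expand-clique G M S) (expand-independent G M S) homogeneous

    result : ∀ w → W ≡ w →
      firstEntry (encodeGraph (induce G S′)) ≡ nil × IsIndependent G S′ ⊎
      firstEntry (encodeGraph (induce G S′)) ≡ nil ∙ nil × IsClique G S′ →
      ∃[ B′ ] (IsIndependent G B′ × ∣ B ∣ ≤ ∣ B′ ∣ ×
      (∀ T → IsIndependent G T → ∣ T ∩ S′ ∣ ≤ ∣ B′ ∣) ×
      round A ⊢ row ∙ encodeState G M B ⇒ encodeState G (M ─ S′) B′ within roundRunTime n a)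
    -- Here `S′` is smaller than `B`, which bounds the intersection with `T` whichever kind of set
    -- `S′` is.
    result (x ∙ y) eqW _ = B , B-independent , ≤-refl ,
          (λ T _ → ≤-trans (∣p∩q∣≤∣q∣ T S′) (≮⇒≥ λ ∣B∣<∣S′∣ → 1+n≢0
            (trans (sym (cong len eqW)) (trans lenW′ (m≤n⇒m∸n≡0 (<⇒≤ ∣B∣<∣S′∣)))))) ,
          run (choose-old (inj₁ (x , y , eqW)))
    result nil eqW (inj₁ (entry , independent)) = S′ , independent ,
          m∸n≡0⇒m≤n (trans (sym lenW′) (cong len eqW)) , (λ T _ → ∣p∩q∣≤∣q∣ T S′) ,
          run (subst (λ w → choose ⊢ _ ∙ (nil ∙ w) ∙ _ ⇒ _ within 39) (sym eqW) (choose-new entry))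
    result nil eqW (inj₂ (entry , clique)) = B , B-independent , ≤-refl ,
          (λ T independent → ≤-trans (clique∩independent G T S′ independent clique) 1≤∣B∣) ,
          run (choose-old (inj₂ (_ , _ , entry)))

-- Peeling

0^n≡0 : ∀ n .{{_ : NonZero n}} → 0 ^ n ≡ 0
0^n≡0 (suc n) = refl

-- In peel, s is the size of a removed set: at least (m + s) ^ (p / q).
data Peeling (p q : ℕ) : ℕ → ℕ → Set where
  stop : Peeling p q 0 0
  peel : ∀ {m k s} → (m + s) ^ p ≤ s ^ q → 1 ≤ s →
         Peeling p q m k → Peeling p q (m + s) (suc k)

module _ {A : Command} {t p q n : ℕ} (G : Graph n)
  (oracle : ∀ M → ∃[ S ] (A ⊢ encodeGraph (induce G M) ⇒ encodeSubset S within t ×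
    (IsClique (induce G M) S ⊎ IsIndependent (induce G M) S) × ∣ M ∣ ^ p ≤ ∣ S ∣ ^ q))
  .{{_ : NonZero q}} where

  PeelingRun : Tree → Subset n → Subset n → ℕ → Set
  PeelingRun rows M B b = ∃[ M′ ] ∃[ B′ ] ∃[ k ] (Peeling p q ∣ M ∣ k ×
    IsIndependent G B′ × ∣ B ∣ ≤ ∣ B′ ∣ ×
    (∀ T → IsIndependent G T → ∣ T ∩ M ∣ ≤ k * ∣ B′ ∣) ×
    forEach (round A) ⊢ rows ∙ encodeState G M B ⇒ nil ∙ encodeState G M′ B′ within b)

  -- The rows merely count the rounds. Each round on a nonempty `M` removes at least one vertex, so
  -- the invariant `∣ M ∣ ≤ l` exhausts `M` by the end of the list.
  rounds-run : ∀ {a} {X : Set a} {l} (e : X → Tree) (rows : Vec X l) (M B : Subset n) → ∣ M ∣ ≤ l →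
    IsIndependent G B → 1 ≤ ∣ B ∣ → PeelingRun (encodeVec e rows) M B (loopTime (roundRunTime n t) l)
  rounds-run e [] M B ∣M∣≤0 independent 1≤∣B∣ =
    M , B , 0 , subst (λ m → Peeling p q m 0) (sym (n≤0⇒n≡0 ∣M∣≤0)) stop ,
    independent , ≤-refl , (λ T _ → ≤-trans (∣p∩q∣≤∣q∣ T M) ∣M∣≤0) , forEach-nil (round A)
  rounds-run e (row ∷ rows) M B ∣M∣≤l independent 1≤∣B∣
    with S , run , homogeneous , large ← oracle M
    with B₁ , independent₁ , B≤B₁ , captured , run₁ ← round-run G M B S run homogeneous independent 1≤∣B∣
    = continue ∣ S ∣ refl
    where
    S′ = expand M S
    M₁ = M ─ S′

    size : ∣ M₁ ∣ + ∣ S ∣ ≡ ∣ M ∣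
    size = ∣─expand∣ M S

    continue : ∀ s → ∣ S ∣ ≡ s → PeelingRun (encodeVec e (row ∷ rows)) M B _
    -- An empty answer gives `∣ M ∣ ^ p ≤ 0 ^ q = 0`, so `M` is already empty. Such idle rounds
    -- leave `k` unchanged, so that `Peeling` records nonempty sets only.
    continue zero ∣S∣≡0 =
      let M₂ , B₂ , k , peeling , independent₂ , B₁≤B₂ , bound , run₂ =
            rounds-run e rows M₁ B₁ (subst (_≤ _) (sym ∣M₁∣≡0) z≤n) independent₁ (≤-trans 1≤∣B∣ B≤B₁)
      in M₂ , B₂ , k , subst (λ m → Peeling p q m k) ∣M₁∣≡∣M∣ peeling , independent₂ ,
         ≤-trans B≤B₁ B₁≤B₂ ,
         (λ T T-independent → begin
           ∣ T ∩ M ∣                 ≤⟨ ∣p∩q∣≤∣q∣ T M ⟩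
           ∣ M ∣                     ≡⟨ ∣M∣≡0 ⟩
           0                         ≤⟨ z≤n ⟩
           k * ∣ B₂ ∣                ∎) ,
         forEach-suc (round A) _ run₁ run₂
      where
      open ≤-Reasoning
      ∣M₁∣≡∣M∣ : ∣ M₁ ∣ ≡ ∣ M ∣
      ∣M₁∣≡∣M∣ = trans (sym (+-identityʳ _)) (trans (cong (∣ M₁ ∣ +_) (sym ∣S∣≡0)) size)
      power≡0 : ∣ S ∣ ^ q ≡ 0
      power≡0 = trans (cong (_^ q) ∣S∣≡0) (0^n≡0 q)
      ∣M∣≡0 : ∣ M ∣ ≡ 0
      ∣M∣≡0 = m^n≡0⇒m≡0 ∣ M ∣ p (n≤0⇒n≡0 (subst (_ ≤_) power≡0 large))
      ∣M₁∣≡0 : ∣ M₁ ∣ ≡ 0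
      ∣M₁∣≡0 = trans ∣M₁∣≡∣M∣ ∣M∣≡0
    continue (suc s) ∣S∣≡1+s =
      let M₂ , B₂ , k , peeling , independent₂ , B₁≤B₂ , bound , run₂ =
            rounds-run e rows M₁ B₁ ∣M₁∣≤ independent₁ (≤-trans 1≤∣B∣ B≤B₁)
      in M₂ , B₂ , suc k ,
         subst (λ m → Peeling p q m (suc k)) size
           (peel (subst (λ m → m ^ p ≤ ∣ S ∣ ^ q) (sym size) large)
             (subst (1 ≤_) (sym ∣S∣≡1+s) (s≤s z≤n)) peeling) ,
         independent₂ , ≤-trans B≤B₁ B₁≤B₂ ,
         (λ T T-independent → begin
           ∣ T ∩ M ∣                 ≤⟨ ∣∩∣-split T M S′ ⟩
           ∣ T ∩ M₁ ∣ + ∣ T ∩ S′ ∣   ≤⟨ +-mono-≤ (bound T T-independent)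
                                         (≤-trans (captured T T-independent) B₁≤B₂) ⟩
           k * ∣ B₂ ∣ + ∣ B₂ ∣       ≡⟨ +-comm (k * ∣ B₂ ∣) ∣ B₂ ∣ ⟩
           suc k * ∣ B₂ ∣            ∎) ,
         forEach-suc (round A) _ run₁ run₂
      where
      open ≤-Reasoning
      ∣M₁∣≤ : ∣ M₁ ∣ ≤ _
      ∣M₁∣≤ = s≤s⁻¹ (begin
        suc ∣ M₁ ∣        ≡⟨ +-comm 1 ∣ M₁ ∣ ⟩
        ∣ M₁ ∣ + 1        ≤⟨ +-monoʳ-≤ ∣ M₁ ∣ (subst (1 ≤_) (sym ∣S∣≡1+s) (s≤s z≤n)) ⟩
        ∣ M₁ ∣ + ∣ S ∣    ≡⟨ size ⟩
        ∣ M ∣             ≤⟨ ∣M∣≤l ⟩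
        _                 ∎)

-- The initial state of the peeling loop

literal : Tree → Expr
literal nil     = nil
literal (t ∙ u) = cons (literal t) (literal u)

⟦literal⟧ : ∀ t {s} → ⟦ literal t ⟧ s ≡ t
⟦literal⟧ nil     = refl
⟦literal⟧ (t ∙ u) = cong₂ _∙_ (⟦literal⟧ t) (⟦literal⟧ u)

repeat : ℕ → Tree → Tree → Tree
repeat zero    x t = t
repeat (suc n) x t = x ∙ repeat n x t

repeat-∙ : ∀ n x t → repeat n x (x ∙ t) ≡ x ∙ repeat n x t
repeat-∙ zero    x t = refl
repeat-∙ (suc n) x t = cong (x ∙_) (repeat-∙ n x t)

encode-replicate : ∀ n b → encodeSubset (replicate n b) ≡ repeat n (encodeBool b) nil
encode-replicate zero    b = refl
encode-replicate (suc n) b = cong (encodeBool b ∙_) (encode-replicate n b)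

fillStep : Tree → Command
fillStep x = X:= cons (literal x) (tl X)

fillTime : Tree → ℕ
fillTime x = 1 + cost (cons (literal x) (tl X))

filling : ∀ x {a} {V : Set a} {n} (e : V → Tree) (vs : Vec V n) t →
  forEach (fillStep x) ⊢ encodeVec e vs ∙ t ⇒ nil ∙ repeat n x t within loopTime (fillTime x) n
filling x         e []       t = forEach-nil (fillStep x)
filling x {n = n} e (v ∷ vs) t = forEach-suc (fillStep x) _
  (assigning (cons (literal x) (tl X)))
  (subst₂ (λ y u → forEach (fillStep x) ⊢ encodeVec e vs ∙ (y ∙ t) ⇒ nil ∙ u within _)
    (sym (⟦literal⟧ x)) (repeat-∙ _ x t) (filling x e vs (x ∙ t)))

peelAll : Command → Command
peelAll A =
  push (cons X nil) (forEach (fillStep (encodeBool true))) ⨾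
  push (cons (drop 1) nil) (forEach (fillStep (encodeBool false))) ⨾
  -- The encoded graph appears twice, as the list that drives the loop and as a component of the
  -- state. Overwriting the first entry of the all-false vector with true gives `⁅ zero ⁆`, the
  -- initial best set.
  X:= cons (drop 2) (cons (drop 2) (cons (tl (item 1)) (cons (cons nil nil) (tl (tl (item 0)))))) ⨾
  forEach (round A) ⨾
  X:= drop 3

peelAllTime : ℕ → ℕ → ℕ
peelAllTime n t =
  pushTime (cons X nil) (loopTime (fillTime (encodeBool true)) n) +
  (pushTime (cons (drop 1) nil) (loopTime (fillTime (encodeBool false)) n) +
  (22 + (loopTime (roundRunTime n t) n + 5)))

filled : ∀ {n} b {a} {V : Set a} (e : V → Tree) (vs : Vec V n) →
  forEach (fillStep (encodeBool b)) ⊢ encodeVec e vs ∙ nil ⇒ nil ∙ encodeSubset (replicate n b)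
    within loopTime (fillTime (encodeBool b)) n
filled {n} b e vs = subst (λ u → _ ⊢ _ ⇒ nil ∙ u within loopTime (fillTime (encodeBool b)) n) (sym (encode-replicate n b))
  (filling (encodeBool b) e vs nil)

peelAll-run : ∀ {A t p q n} (G : Graph (suc n)) .{{_ : NonZero q}} →
  (∀ M → ∃[ S ] (A ⊢ encodeGraph (induce G M) ⇒ encodeSubset S within t ×
    (IsClique (induce G M) S ⊎ IsIndependent (induce G M) S) × ∣ M ∣ ^ p ≤ ∣ S ∣ ^ q)) →
  ∃[ B ] ∃[ k ] (Peeling p q (suc n) k × IsIndependent G B × α G ≤ k * ∣ B ∣ ×
    peelAll A ⊢ encodeGraph G ⇒ encodeSubset B within peelAllTime (suc n) t)
peelAll-run {A} {t} {p} {q} {n} G oracle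
  with T , T-independent , ∣T∣≡α ← α-attained G
  with M , B , k , peeling , independent , _ , bound , run ←
         rounds-run {A} {t} {p} {q} G oracle (encodeVec encodeBool) (tabulate λ i → tabulate (adj G i)) ⊤ ⁅ zero ⁆
           (∣p∣≤n ⊤) (∣∣≤1⇒independent G ⁅ zero ⁆ (≤-reflexive (∣⁅x⁆∣≡1 {suc n} zero)))
           (≤-reflexive (sym (∣⁅x⁆∣≡1 {suc n} zero)))
  = B , k , subst (λ m → Peeling p q m k) (∣⊤∣≡n (suc n)) peeling , independent ,
    subst (_≤ k * ∣ B ∣) ∣T∣≡α
      (subst (λ U → ∣ U ∣ ≤ k * ∣ B ∣) (∩-identityʳ T) (bound T T-independent)) ,
    (pushing (forEach (fillStep (encodeBool true))) (cons X nil)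
       (filled true (encodeVec encodeBool) (tabulate λ i → tabulate (adj G i))) ⨟
     pushing (forEach (fillStep (encodeBool false))) (cons (drop 1) nil)
       (filled false (encodeVec encodeBool) (tabulate λ i → tabulate (adj G i))) ⨟
     assigning (cons (drop 2) (cons (drop 2) (cons (tl (item 1)) (cons (cons nil nil) (tl (tl (item 0))))))) ⨟
     run ⨟
     assigning (drop 3))

-- Small graphs: a decision tree on the adjacency matrix, with the answers
-- hard-coded at its leaves.

readVec : ∀ m → Expr → (Vec Bool m → Command) → Command
readVec zero    E K = K []
readVec (suc m) E K = if hd E
  then readVec m (tl E) (λ v → K (true ∷ v))
  else readVec m (tl E) (λ v → K (false ∷ v))

readVecTime : ℕ → Expr → ℕ → ℕ
readVecTime zero    E b = b
readVecTime (suc m) E b = 1 + cost (hd E) + readVecTime m (tl E) b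

readVec-run : ∀ {m s t b} E K (v : Vec Bool m) → ⟦ E ⟧ s ≡ encodeSubset v → K v ⊢ s ⇒ t within b →
  readVec m E K ⊢ s ⇒ t within readVecTime m E b
readVec-run E K []          eq run = run
readVec-run E K (true ∷ v)  eq run =
  branching-true (cong head eq) (readVec-run (tl E) (K ∘ (true ∷_)) v (cong tail eq) run)
readVec-run E K (false ∷ v) eq run =
  branching-false (cong head eq) (readVec-run (tl E) (K ∘ (false ∷_)) v (cong tail eq) run)

readMatrix : ∀ m n → Expr → (Vec (Vec Bool n) m → Command) → Command
readMatrix zero    n E K = K []
readMatrix (suc m) n E K = readVec n (hd E) λ v → readMatrix m n (tl E) λ rows → K (v ∷ rows)

readMatrixTime : ℕ → ℕ → Expr → ℕ → ℕ
readMatrixTime zero    n E b = b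
readMatrixTime (suc m) n E b = readVecTime n (hd E) (readMatrixTime m n (tl E) b)

readMatrix-run : ∀ {m n s t b} E K (rows : Vec (Vec Bool n) m) →
  ⟦ E ⟧ s ≡ encodeVec encodeSubset rows → K rows ⊢ s ⇒ t within b →
  readMatrix m n E K ⊢ s ⇒ t within readMatrixTime m n E b
readMatrix-run E K []         eq run = run
readMatrix-run E K (v ∷ rows) eq run =
  readVec-run (hd E) _ v (cong head eq) (readMatrix-run (tl E) (K ∘ (v ∷_)) rows (cong tail eq) run)

-- Symmetrised, so that every Boolean matrix has a graph.
matrixGraph : ∀ {n} → Vec (Vec Bool n) n → Graph n
matrixGraph {n} rows = record { adj = edge ; symmetric = edge-sym ; irreflexive = edge-irrefl }
  where
  entry : Fin n → Fin n → Bool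
  entry i j = lookup (lookup rows i) j
  edge : Fin n → Fin n → Bool
  edge i j = not (does (i Fin.≟ j)) ∧ (entry i j ∧ entry j i)
  edge-sym : ∀ i j → edge i j ≡ edge j i
  edge-sym i j with i Fin.≟ j | j Fin.≟ i
  ... | yes _   | yes _   = refl
  ... | no _    | no _    = ∧-comm (entry i j) (entry j i)
  ... | yes i≡j | no j≢i  = contradiction (sym i≡j) j≢i
  ... | no i≢j  | yes j≡i = contradiction (sym j≡i) i≢j
  edge-irrefl : ∀ i → edge i i ≡ false
  edge-irrefl i with i Fin.≟ i
  ... | yes _  = refl
  ... | no i≢i = contradiction refl i≢i

matrix : ∀ {n} → Graph n → Vec (Vec Bool n) n
matrix G = tabulate λ i → tabulate (adj G i)

matrixGraph-matrix : ∀ {n} (G : Graph n) i j → adj (matrixGraph (matrix G)) i j ≡ adj G i j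
matrixGraph-matrix G i j
  rewrite lookup∘tabulate (λ i → tabulate (adj G i)) i | lookup∘tabulate (λ i → tabulate (adj G i)) j
        | lookup∘tabulate (adj G i) j | lookup∘tabulate (adj G j) i | symmetric G j i | ∧-idem (adj G i j)
  with i Fin.≟ j
... | yes refl = sym (irreflexive G i)
... | no _     = refl

maximum : ∀ {n} → Graph n → Subset n
maximum G = proj₁ (α-attained G)

answer : ℕ → Command
answer n = readMatrix n n X λ rows → X:= literal (encodeSubset (maximum (matrixGraph rows)))

cost-literal : ∀ {n} (S : Subset n) → cost (literal (encodeSubset S)) ≤ 1 + n * 4
cost-literal []          = ≤-refl
cost-literal (true ∷ S)  = s≤s (+-monoʳ-≤ 3 (cost-literal S))
cost-literal (false ∷ S) = s≤s (s≤s (m≤n⇒m≤o+n 2 (cost-literal S)))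

answerTime : ℕ → ℕ
answerTime n = readMatrixTime n n X (2 + n * 4)

-- The graph rebuilt from the matrix agrees with `G` pair by pair, so independent sets transfer in
-- both directions and a maximum one there is a maximum one in `G`.
answer-run : ∀ {n} (G : Graph n) → ∃[ I ] (IsIndependent G I × α G ≤ ∣ I ∣ ×
  answer n ⊢ encodeGraph G ⇒ encodeSubset I within answerTime n)
answer-run {n} G with T , T-independent , ∣T∣≡α ← α-attained G =
  I ,
  (λ i j i∈ j∈ → trans (sym (matrixGraph-matrix G i j)) (I-independent i j i∈ j∈)) ,
  subst₂ _≤_ ∣T∣≡α (sym ∣I∣≡α) (α-upper G′ T λ i j i∈ j∈ →
    trans (matrixGraph-matrix G i j) (T-independent i j i∈ j∈)) ,
  readMatrix-run X _ (matrix G) refl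
    (subst (λ t → X:= literal (encodeSubset I) ⊢ encodeGraph G ⇒ t within 2 + n * 4)
      (⟦literal⟧ (encodeSubset I))
      (relax (s≤s (cost-literal I)) (assigning (literal (encodeSubset I)))))
  where
  G′ = matrixGraph (matrix G)
  I = maximum G′
  I-independent = proj₁ (proj₂ (α-attained G′))
  ∣I∣≡α = proj₂ (proj₂ (α-attained G′))

-- E holds the part of the input list that remains after i items.
bySize : ℕ → ℕ → Expr → (ℕ → Command) → Command → Command
bySize zero    i E K D = D
bySize (suc N) i E K D = if E then bySize N (suc i) (tl E) K D else K i

bySizeTime : ℕ → Expr → ℕ
bySizeTime zero    E = 0
bySizeTime (suc N) E = 1 + cost E + bySizeTime N (tl E)

bySize-small : ∀ {K D s t b} N i E → len (⟦ E ⟧ s) < N → K (i + len (⟦ E ⟧ s)) ⊢ s ⇒ t within b →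
  bySize N i E K D ⊢ s ⇒ t within bySizeTime N E + b
bySize-small {K} {s = s} {t} {b} (suc N) i E small run with ⟦ E ⟧ s in eq
... | nil    = relax (+-monoˡ-≤ b (m≤m+n _ _))
  (branching-false eq (subst (λ j → K j ⊢ s ⇒ t within b) (+-identityʳ i) run))
... | x ∙ xs = relax (≤-reflexive (sym (+-assoc (1 + cost E) _ b)))
  (branching-true eq (bySize-small N (suc i) (tl E) (subst (λ r → len (tail r) < N) (sym eq) (s≤s⁻¹ small))
    (subst (λ r → K (suc i + len (tail r)) ⊢ s ⇒ t within b) (sym eq)
      (subst (λ j → K j ⊢ s ⇒ t within b) (+-suc i (len xs)) run))))

bySize-large : ∀ {K D s t b} N i E → N ≤ len (⟦ E ⟧ s) → D ⊢ s ⇒ t within b →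
  bySize N i E K D ⊢ s ⇒ t within bySizeTime N E + b
bySize-large                 zero    i E _     run = run
bySize-large {s = s} {b = b} (suc N) i E large run with ⟦ E ⟧ s in eq
... | x ∙ xs = relax (≤-reflexive (sym (+-assoc (1 + cost E) _ b)))
  (branching-true eq (bySize-large N (suc i) (tl E) (subst (λ r → N ≤ len (tail r)) (sym eq) (s≤s⁻¹ large)) run))

-- Polynomial bounds

-- With base `suc n`, which is never 0, powers grow with the exponent, so that sums and products of
-- bounds only need the exponents added.
Polynomial : (ℕ → ℕ) → Set
Polynomial f = ∃[ c ] ∃[ d ] (∀ n → f n ≤ c * suc n ^ d)

constant-polynomial : ∀ c → Polynomial (λ _ → c)
constant-polynomial c = c , 0 , λ n → ≤-reflexive (sym (*-identityʳ c))

identity-polynomial : Polynomial (λ n → n)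
identity-polynomial = 1 , 1 , λ n → ≤-trans (n≤1+n n)
  (≤-reflexive (sym (trans (*-identityˡ (suc n ^ 1)) (*-identityʳ (suc n)))))

infixl 6 _+ᵖ_
infixl 7 _*ᵖ_

_+ᵖ_ : ∀ {f g} → Polynomial f → Polynomial g → Polynomial (λ n → f n + g n)
(c , d , f≤) +ᵖ (c′ , d′ , g≤) = c + c′ , d + d′ , λ n →
  ≤-trans (+-mono-≤
      (≤-trans (f≤ n) (*-monoʳ-≤ c (^-monoʳ-≤ (suc n) (m≤m+n d d′))))
      (≤-trans (g≤ n) (*-monoʳ-≤ c′ (^-monoʳ-≤ (suc n) (m≤n+m d′ d)))))
    (≤-reflexive (sym (*-distribʳ-+ (suc n ^ (d + d′)) c c′)))

_*ᵖ_ : ∀ {f g} → Polynomial f → Polynomial g → Polynomial (λ n → f n * g n)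
(c , d , f≤) *ᵖ (c′ , d′ , g≤) = c * c′ , d + d′ , λ n →
  ≤-trans (*-mono-≤ (f≤ n) (g≤ n)) (≤-reflexive (trans
    ([m*n]*[o*p]≡[m*o]*[n*p] c (suc n ^ d) c′ (suc n ^ d′))
    (cong (c * c′ *_) (sym (^-distribˡ-+-* (suc n) d d′)))))

^-polynomial : ∀ d → Polynomial (_^ d)
^-polynomial zero    = constant-polynomial 1
^-polynomial (suc d) = identity-polynomial *ᵖ ^-polynomial d

^-distribʳ-* : ∀ d m n → (m * n) ^ d ≡ m ^ d * n ^ d
^-distribʳ-* zero    m n = refl
^-distribʳ-* (suc d) m n =
  trans (cong (m * n *_) (^-distribʳ-* d m n)) ([m*n]*[o*p]≡[m*o]*[n*p] m n (m ^ d) (n ^ d))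

-- For positive n the base `suc n` is at most `2 * n`, which costs the factor `2 ^ d`; at 0 the
-- additive constant takes over.
polynomial-bound : ∀ {f} → Polynomial f → ∃[ c ] ∃[ d ] (∀ n → f n ≤ c * n ^ d + c)
polynomial-bound {f} (c , d , f≤) = c * 2 ^ d , d , bound
  where
  open ≤-Reasoning
  bound : ∀ n → f n ≤ c * 2 ^ d * n ^ d + c * 2 ^ d
  bound zero = begin
    f 0                                ≤⟨ f≤ 0 ⟩
    c * 1 ^ d                          ≤⟨ *-monoʳ-≤ c (^-monoˡ-≤ d (s≤s z≤n)) ⟩
    c * 2 ^ d                          ≤⟨ m≤n+m (c * 2 ^ d) _ ⟩
    c * 2 ^ d * 0 ^ d + c * 2 ^ d      ∎
  bound (suc n) = begin
    f (suc n)                              ≤⟨ f≤ (suc n) ⟩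
    c * (2 + n) ^ d                        ≤⟨ *-monoʳ-≤ c (^-monoˡ-≤ d (s≤s (s≤s (m≤m+n n (n + 0))))) ⟩
    c * (2 + (n + (n + 0))) ^ d            ≡⟨ cong (λ m → c * m ^ d) (*-suc 2 n) ⟨
    c * (2 * suc n) ^ d                    ≡⟨ cong (c *_) (^-distribʳ-* d 2 (suc n)) ⟩
    c * (2 ^ d * suc n ^ d)                ≡⟨ *-assoc c (2 ^ d) (suc n ^ d) ⟨
    c * 2 ^ d * suc n ^ d                  ≤⟨ m≤m+n _ _ ⟩
    c * 2 ^ d * suc n ^ d + c * 2 ^ d      ∎

opaque
  unfolding pushTime forEach transduce

  pushTime-polynomial : ∀ E {f} → Polynomial f → Polynomial (λ n → pushTime E (f n))
  pushTime-polynomial E f = constant-polynomial (1 + cost (cons E X)) +ᵖ constant-polynomial 4 *ᵖ f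

  loopTime-polynomial : ∀ {f} → Polynomial f → Polynomial (λ n → loopTime (f n) n)
  loopTime-polynomial f =
    identity-polynomial *ᵖ (constant-polynomial 20 +ᵖ constant-polynomial 4 *ᵖ f) +ᵖ constant-polynomial 3

  transduceTime-polynomial : ∀ {f} → Polynomial f → Polynomial (λ n → transduceTime (f n) n)
  transduceTime-polynomial f =
    constant-polynomial 8 +ᵖ (f +ᵖ (constant-polynomial 6 +ᵖ
      (loopTime-polynomial (constant-polynomial 2) +ᵖ constant-polynomial 3)))

filterTime-polynomial : Polynomial filterTime
filterTime-polynomial = transduceTime-polynomial (loopTime-polynomial (constant-polynomial 17))

submatrixTime-polynomial : Polynomial submatrixTime
submatrixTime-polynomial = transduceTime-polynomial (loopTime-polynomial
  (constant-polynomial 3 +ᵖ (pushTime-polynomial _ filterTime-polynomial +ᵖ constant-polynomial 21)))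

peelAllTime-polynomial : ∀ {f} → Polynomial f → Polynomial (λ n → peelAllTime n (f n))
peelAllTime-polynomial f =
  pushTime-polynomial _ (loopTime-polynomial (constant-polynomial _)) +ᵖ
  (pushTime-polynomial _ (loopTime-polynomial (constant-polynomial _)) +ᵖ
  (constant-polynomial 22 +ᵖ (loopTime-polynomial (
    constant-polynomial 3 +ᵖ (pushTime-polynomial _ submatrixTime-polynomial +ᵖ
    (constant-polynomial 4 *ᵖ f +ᵖ
    (pushTime-polynomial _ filterTime-polynomial +ᵖ
    (pushTime-polynomial _ submatrixTime-polynomial +ᵖ
    (pushTime-polynomial _ filterTime-polynomial +ᵖ
    (pushTime-polynomial _ filterTime-polynomial +ᵖ
    (pushTime-polynomial _ (loopTime-polynomial (constant-polynomial 4)) +ᵖ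
    (pushTime-polynomial _ filterTime-polynomial +ᵖ
    constant-polynomial 39))))))))) +ᵖ constant-polynomial 5)))

-- Counting the removed sets

n<2^n : ∀ n → n < 2 ^ n
n<2^n zero    = s≤s z≤n
n<2^n (suc n) = begin
  2 + n              ≤⟨ s≤s (n<2^n n) ⟩
  1 + 2 ^ n          ≤⟨ +-monoˡ-≤ (2 ^ n) (m^n>0 2 n) ⟩
  2 ^ n + 2 ^ n      ≡⟨ cong (2 ^ n +_) (+-identityʳ (2 ^ n)) ⟨
  2 ^ suc n          ∎
  where open ≤-Reasoning

binary-logarithm : ∀ n → 1 ≤ n → ∃[ k ] (2 ^ k ≤ n × n < 2 ^ suc k)
binary-logarithm (suc zero)      _ = 0 , s≤s z≤n , s≤s (s≤s z≤n)
binary-logarithm (suc n@(suc _)) _ with k , 2^k≤n , n<2^1+k ← binary-logarithm n (s≤s z≤n)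
  with suc n <? 2 ^ suc k
... | yes small = k , m≤n⇒m≤1+n 2^k≤n , small
... | no large  = suc k , ≮⇒≥ large , ≤-<-trans n<2^1+k (^-monoʳ-< 2 (s≤s (s≤s z≤n)) (n<1+n (suc k)))

-- Write `a = C + j`. Then `C ≤ 2 ^ C`, and `C < j` gives `suc (C + j) ≤ j + j ≤ 2 ^ j`.
linear≤exponential : ∀ C a → 2 * C < a → C * suc a ≤ 2 ^ a
linear≤exponential C a 2C<a
  with j , refl ← m≤n⇒∃[o]m+o≡n {C} {a} (≤-trans (m≤m+n C (C + 0)) (<⇒≤ 2C<a)) = begin
  C * suc (C + j)     ≤⟨ *-mono-≤ (<⇒≤ (n<2^n C)) 1+C+j≤2^j ⟩
  2 ^ C * 2 ^ j       ≡⟨ ^-distribˡ-+-* 2 C j ⟨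
  2 ^ (C + j)         ∎
  where
  open ≤-Reasoning
  C<j : C < j
  C<j = +-cancelˡ-< C C j (subst (λ m → C + m < C + j) (+-identityʳ C) 2C<a)
  2j≤2^j : ∀ j → 1 ≤ j → j + j ≤ 2 ^ j
  2j≤2^j (suc j) _ = ≤-trans (+-mono-≤ (n<2^n j) (n<2^n j))
    (≤-reflexive (cong (2 ^ j +_) (sym (+-identityʳ (2 ^ j)))))
  1+C+j≤2^j : suc (C + j) ≤ 2 ^ j
  1+C+j≤2^j = ≤-trans (+-monoˡ-≤ j C<j) (2j≤2^j j (≤-<-trans z≤n C<j))

-- While at least 2 ^ k vertices are left, the removed sets have size at least
-- 2 ^ saving k, so that at most about 2 ^ cofactor k of them halve the rest.
module _ {p q : ℕ} .{{_ : NonZero q}} (p≤q : p ≤ q) where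

  private
    saving cofactor bound : ℕ → ℕ
    saving k = k * p / q
    cofactor k = k ∸ saving k
    bound zero    = 0
    bound (suc k) = 2 * 2 ^ cofactor k + bound k

  saving≤ : ∀ k → saving k ≤ k
  saving≤ k = ≤-trans (/-monoˡ-≤ q (*-monoʳ-≤ k p≤q)) (≤-reflexive (m*n/n≡m k q))

  cofactor+saving : ∀ k → cofactor k + saving k ≡ k
  cofactor+saving k = m∸n+n≡m (saving≤ k)

  next-saving : ∀ k → k * p < suc (saving k) * q
  next-saving k = begin-strict
    k * p                         ≡⟨ m≡m%n+[m/n]*n (k * p) q ⟩
    k * p % q + saving k * q      <⟨ +-monoˡ-< (saving k * q) (m%n<n (k * p) q) ⟩
    q + saving k * q              ∎
    where open ≤-Reasoning

  saving-suc : ∀ k → saving (suc k) ≤ suc (saving k)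
  saving-suc k = s≤s⁻¹ (m<n*o⇒m/o<n {suc k * p} {suc (suc (saving k))} {q}
    (+-mono-≤-< p≤q (next-saving k)))

  -- Since `p ≤ q`, the floor `saving` rises by at most one per step. This lets `bound≤` replace
  -- every summand of `bound` by the last one, at the price of a factor `k`, the logarithm.
  cofactor-mono : ∀ k → cofactor k ≤ cofactor (suc k)
  cofactor-mono k = ∸-monoʳ-≤ (suc k) (saving-suc k)

  large-set : ∀ k s → (2 ^ k) ^ p ≤ s ^ q → 2 ^ saving k ≤ s
  large-set k s large = ≮⇒≥ λ s<2^e → <⇒≱ (begin-strict
    s ^ q                 <⟨ ^-monoˡ-< q s<2^e ⟩
    (2 ^ saving k) ^ q    ≡⟨ ^-*-assoc 2 (saving k) q ⟩
    2 ^ (saving k * q)    ≤⟨ ^-monoʳ-≤ 2 (m/n*n≤m (k * p) q) ⟩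
    2 ^ (k * p)           ≡⟨ ^-*-assoc 2 k p ⟨
    (2 ^ k) ^ p           ∎) large
    where open ≤-Reasoning

  -- Induction on the scale: `weighted` at scale `k` with `m < 2 ^ suc k`, divided by
  -- `2 ^ saving k`, adds the summand `2 * 2 ^ cofactor k`.
  peeling≤bound : ∀ k {m c} → Peeling p q m c → m < 2 ^ k → c ≤ bound k
  -- A charging argument: a set removed while at least `2 ^ k` vertices are left pays its weight
  -- `2 ^ saving k` with its own vertices, and all later sets are counted by `bound k`.
  weighted : ∀ k {m c} → Peeling p q m c → c * 2 ^ saving k ≤ m + bound k * 2 ^ saving k

  peeling≤bound zero    stop                  _    = z≤n
  peeling≤bound zero    (peel {m} _ 1≤s _) m+s<1 =
    contradiction (≤-trans 1≤s (m≤n+m _ m)) (<⇒≱ m+s<1)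
  peeling≤bound (suc k) {m} {c} peeling m<2^1+k = *-cancelʳ-≤ c (bound (suc k)) E {{m^n≢0 2 (saving k)}} (begin
    c * E                                    ≤⟨ weighted k peeling ⟩
    m + bound k * E                          ≤⟨ +-monoˡ-≤ (bound k * E) (<⇒≤ m<2^1+k) ⟩
    2 * 2 ^ k + bound k * E                  ≡⟨ cong (λ j → 2 * 2 ^ j + bound k * E) (cofactor+saving k) ⟨
    2 * 2 ^ (cofactor k + saving k) + bound k * E
      ≡⟨ cong (λ x → 2 * x + bound k * E) (^-distribˡ-+-* 2 (cofactor k) (saving k)) ⟩
    2 * (2 ^ cofactor k * E) + bound k * E   ≡⟨ cong (_+ bound k * E) (*-assoc 2 (2 ^ cofactor k) E) ⟨
    2 * 2 ^ cofactor k * E + bound k * E     ≡⟨ *-distribʳ-+ E (2 * 2 ^ cofactor k) (bound k) ⟨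
    bound (suc k) * E                        ∎)
    where
    open ≤-Reasoning
    E = 2 ^ saving k

  weighted k stop = z≤n
  weighted k (peel {m} {c} {s} large 1≤s peeling) with m + s <? 2 ^ k
  ... | yes small = ≤-trans (*-monoˡ-≤ (2 ^ saving k) (peeling≤bound k (peel large 1≤s peeling) small)) (m≤n+m _ (m + s))
  ... | no ≮2^k   = begin
    E + c * E                 ≤⟨ +-mono-≤ (large-set k s (≤-trans (^-monoˡ-≤ p (≮⇒≥ ≮2^k)) large)) (weighted k peeling) ⟩
    s + (m + bound k * E)     ≡⟨ +-assoc s m _ ⟨
    s + m + bound k * E       ≡⟨ cong (_+ bound k * E) (+-comm s m) ⟩
    m + s + bound k * E       ∎
    where
    open ≤-Reasoning
    E = 2 ^ saving k

  bound≤ : ∀ k → bound k ≤ 2 * k * 2 ^ cofactor k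
  bound≤ zero    = z≤n
  bound≤ (suc k) = begin
    2 * 2 ^ cofactor k + bound k                   ≤⟨ +-monoʳ-≤ (2 * 2 ^ cofactor k) (bound≤ k) ⟩
    2 * 2 ^ cofactor k + 2 * k * 2 ^ cofactor k    ≡⟨ *-distribʳ-+ (2 ^ cofactor k) 2 (2 * k) ⟨
    (2 + 2 * k) * 2 ^ cofactor k                   ≡⟨ cong (_* 2 ^ cofactor k) (*-suc 2 k) ⟨
    2 * suc k * 2 ^ cofactor k                     ≤⟨ *-monoʳ-≤ (2 * suc k) (^-monoʳ-≤ 2 (cofactor-mono k)) ⟩
    2 * suc k * 2 ^ cofactor (suc k)               ∎
    where open ≤-Reasoning

  -- That is, `cofactor (suc k)` is at most `k * (1 - p / q) + 2`: one unit is lost to the floor and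
  -- one to the shift from `k` to `suc k`.
  cofactor-bound : ∀ k → cofactor (suc k) * q + k * p ≤ (k + 2) * q
  cofactor-bound k = begin
    cofactor (suc k) * q + k * p                              ≤⟨ +-monoʳ-≤ (cofactor (suc k) * q)
                                                                   (≤-trans (m≤n+m (k * p) p) (<⇒≤ (next-saving (suc k)))) ⟩
    cofactor (suc k) * q + suc (saving (suc k)) * q           ≡⟨ *-distribʳ-+ q (cofactor (suc k)) _ ⟨
    (cofactor (suc k) + suc (saving (suc k))) * q             ≡⟨ cong (_* q) (+-suc (cofactor (suc k)) _) ⟩
    suc (cofactor (suc k) + saving (suc k)) * q               ≡⟨ cong (λ j → suc j * q) (cofactor+saving (suc k)) ⟩
    (2 + k) * q                                               ≡⟨ cong (_* q) (+-comm 2 k) ⟩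
    (k + 2) * q                                               ∎
    where open ≤-Reasoning

  -- In fractions: `l + cofactor (suc k)` is at most `l + 2 + k * (1 - p / q)`, then
  -- `k / N + k * (1 - p / q)` by the first inequality, and `k * p′ / q′` by the second.
  exponent-bound : ∀ N .{{_ : NonZero N}} k l p′ q′ → N * (l + 2) ≤ k →
    suc N * (q * q′) ≤ N * (p′ * q + p * q′) →
    (l + cofactor (suc k)) * q′ ≤ k * p′
  exponent-bound N k l p′ q′ small gap =
    *-cancelˡ-≤ (N * q) {{m*n≢0 N q}} (+-cancelʳ-≤ (N * k * p * q′) _ _ (begin
      N * q * ((l + u) * q′) + N * k * p * q′       ≡⟨ solve 7 (λ N q l u q′ k p →
          N :* q :* ((l :+ u) :* q′) :+ N :* k :* p :* q′ :=
          N :* q′ :* (l :* q :+ (u :* q :+ k :* p))) refl N q l u q′ k p ⟩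
      N * q′ * (l * q + (u * q + k * p))            ≤⟨ *-monoʳ-≤ (N * q′) (+-monoʳ-≤ (l * q) (cofactor-bound k)) ⟩
      N * q′ * (l * q + (k + 2) * q)                ≡⟨ solve 5 (λ N q′ l q k →
          N :* q′ :* (l :* q :+ (k :+ con 2) :* q) :=
          (N :* (l :+ con 2) :+ N :* k) :* (q :* q′)) refl N q′ l q k ⟩
      (N * (l + 2) + N * k) * (q * q′)              ≤⟨ *-monoˡ-≤ (q * q′) (+-monoˡ-≤ (N * k) small) ⟩
      (k + N * k) * (q * q′)                        ≡⟨ solve 4 (λ N q′ q k →
          (k :+ N :* k) :* (q :* q′) := k :* ((con 1 :+ N) :* (q :* q′))) refl N q′ q k ⟩
      k * (suc N * (q * q′))                        ≤⟨ *-monoʳ-≤ k gap ⟩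
      k * (N * (p′ * q + p * q′))                   ≡⟨ solve 6 (λ N q′ q k p p′ →
          k :* (N :* (p′ :* q :+ p :* q′)) :=
          N :* q :* (k :* p′) :+ N :* k :* p :* q′) refl N q′ q k p p′ ⟩
      N * q * (k * p′) + N * k * p * q′             ∎))
    where
    open ≤-Reasoning
    open +-*-Solver
    u = cofactor (suc k)

  -- The threshold is chosen before `p′` and `q′`: the gap `1 / N` serves all these fractions at
  -- once. For n between `2 ^ k` and `2 ^ suc k` the factor `2 * suc k` is absorbed by `2 ^ l`, with
  -- `l` about `k / N`.
  few-sets : ∀ N .{{_ : NonZero N}} → ∃[ n₀ ] (∀ {n c} → n₀ ≤ n → Peeling p q n c → ∀ p′ q′ →
    suc N * (q * q′) ≤ N * (p′ * q + p * q′) → c ^ q′ ≤ n ^ p′)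
  few-sets N = 2 ^ k₀ , few
    where
    open ≤-Reasoning
    C a₀ k₀ : ℕ
    -- With `a = k / N`, four times the factor `2 * suc k` is at most `8 * N * suc a`; `a₀` exceeds
    -- `2 * C`, as `linear≤exponential` demands.
    C = 8 * N
    a₀ = 2 + 2 * C
    k₀ = N * a₀

    few : ∀ {n c} → 2 ^ k₀ ≤ n → Peeling p q n c → ∀ p′ q′ →
      suc N * (q * q′) ≤ N * (p′ * q + p * q′) → c ^ q′ ≤ n ^ p′
    few {n} {c} n₀≤n peeling p′ q′ gap
      with k , 2^k≤n , n<2^1+k ← binary-logarithm n (≤-trans (m^n>0 2 k₀) n₀≤n) = begin
        c ^ q′                               ≤⟨ ^-monoˡ-≤ q′ (≤-trans (peeling≤bound (suc k) peeling n<2^1+k) (bound≤ (suc k))) ⟩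
        (2 * suc k * 2 ^ cofactor (suc k)) ^ q′    ≤⟨ ^-monoˡ-≤ q′ (*-monoˡ-≤ (2 ^ cofactor (suc k)) 2[1+k]≤2^l) ⟩
        (2 ^ l * 2 ^ cofactor (suc k)) ^ q′  ≡⟨ cong (_^ q′) (^-distribˡ-+-* 2 l (cofactor (suc k))) ⟨
        (2 ^ (l + cofactor (suc k))) ^ q′    ≡⟨ ^-*-assoc 2 (l + cofactor (suc k)) q′ ⟩
        2 ^ ((l + cofactor (suc k)) * q′)    ≤⟨ ^-monoʳ-≤ 2 (exponent-bound N k l p′ q′ N[l+2]≤k gap) ⟩
        2 ^ (k * p′)                         ≡⟨ ^-*-assoc 2 k p′ ⟨
        (2 ^ k) ^ p′                         ≤⟨ ^-monoˡ-≤ p′ 2^k≤n ⟩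
        n ^ p′                               ∎
      where
      a l : ℕ
      a = k / N
      -- The two units held back pay for the 2 in `cofactor-bound`; they are the reason for the
      -- factor 4 below.
      l = a ∸ 2

      k₀≤k : k₀ ≤ k
      k₀≤k = s≤s⁻¹ (≰⇒> λ 1+k≤k₀ → <⇒≱ (<-≤-trans n<2^1+k (^-monoʳ-≤ 2 1+k≤k₀)) n₀≤n)

      a₀≤a : a₀ ≤ a
      a₀≤a = subst (_≤ a) (trans (cong (_/ N) (*-comm N a₀)) (m*n/n≡m a₀ N)) (/-monoˡ-≤ N k₀≤k)

      l+2≡a : l + 2 ≡ a
      l+2≡a = m∸n+n≡m (≤-trans (m≤m+n 2 (2 * C)) a₀≤a)

      N[l+2]≤k : N * (l + 2) ≤ k
      N[l+2]≤k = begin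
        N * (l + 2)    ≡⟨ cong (N *_) l+2≡a ⟩
        N * a          ≡⟨ *-comm N a ⟩
        a * N          ≤⟨ m/n*n≤m k N ⟩
        k              ∎

      k<N[1+a] : suc k ≤ suc a * N
      k<N[1+a] = begin
        suc k                ≡⟨ cong suc (m≡m%n+[m/n]*n k N) ⟩
        suc (k % N + a * N)  ≤⟨ +-monoˡ-≤ (a * N) (m%n<n k N) ⟩
        suc a * N            ∎

      2[1+k]≤2^l : 2 * suc k ≤ 2 ^ l
      2[1+k]≤2^l = *-cancelˡ-≤ 4 (begin
        4 * (2 * suc k)        ≤⟨ *-monoʳ-≤ 4 (*-monoʳ-≤ 2 k<N[1+a]) ⟩
        4 * (2 * (suc a * N))  ≡⟨ solve 2 (λ a N → con 4 :* (con 2 :* (a :* N)) := con 8 :* N :* a) refl (suc a) N ⟩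
        C * suc a              ≤⟨ linear≤exponential C a (≤-trans (n≤1+n _) a₀≤a) ⟩
        2 ^ a                  ≡⟨ cong (2 ^_) l+2≡a ⟨
        2 ^ (l + 2)            ≡⟨ ^-distribˡ-+-* 2 l 2 ⟩
        2 ^ l * 4              ≡⟨ *-comm (2 ^ l) 4 ⟩
        4 * 2 ^ l              ∎)
        where open +-*-Solver

-- Real and rational exponents

p≤∣p∣ : ∀ p → p ℚ.≤ ℚ.∣ p ∣
p≤∣p∣ p with ℚ.≤-total 0ℚ p
... | inj₁ 0≤p = ℚ.≤-reflexive (sym (ℚ.0≤p⇒∣p∣≡p 0≤p))
... | inj₂ p≤0 = ℚ.≤-trans p≤0 (ℚ.0≤∣p∣ p)

0≤p*p : ∀ p → 0ℚ ℚ.≤ p ℚ.* p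
0≤p*p p with ℚ.≤-total 0ℚ p
... | inj₁ 0≤p = ℚ.nonNegative⁻¹ (p ℚ.* p) {{ℚ.nonNeg*nonNeg⇒nonNeg p {{ℚ.nonNegative 0≤p}} p {{ℚ.nonNegative 0≤p}}}}
... | inj₂ p≤0 = ℚ.nonNegative⁻¹ (p ℚ.* p) {{ℚ.nonPos*nonPos⇒nonPos p {{ℚ.nonPositive p≤0}} p {{ℚ.nonPositive p≤0}}}}

∣p-q∣<r⇒p≤q+r : ∀ p q {r} → ℚ.∣ p ℚ.- q ∣ ℚ.< r → p ℚ.≤ q ℚ.+ r
∣p-q∣<r⇒p≤q+r p q {r} close = begin
  p                ≡⟨ solve 2 (λ p q → p := q :+ (p :- q)) refl p q ⟩
  q ℚ.+ (p ℚ.- q)  ≤⟨ ℚ.+-monoʳ-≤ q (ℚ.≤-trans (p≤∣p∣ (p ℚ.- q)) (ℚ.<⇒≤ close)) ⟩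
  q ℚ.+ r          ∎
  where
  open ℚ.≤-Reasoning
  open ℚ.+-*-Solver

p≤p+q : ∀ p {q} → 0ℚ ℚ.≤ q → p ℚ.≤ p ℚ.+ q
p≤p+q p {q} 0≤q = subst (ℚ._≤ p ℚ.+ q) (ℚ.+-identityʳ p) (ℚ.+-monoʳ-≤ p 0≤q)

common-lower-bound : ∀ {p q} → 0ℚ ℚ.< p → 0ℚ ℚ.< q → ∃[ r ] (0ℚ ℚ.< r × r ℚ.≤ p × r ℚ.≤ q)
common-lower-bound {p} {q} 0<p 0<q with ℚ.≤-total p q
... | inj₁ p≤q = p , 0<p , ℚ.≤-refl , p≤q
... | inj₂ q≤p = q , 0<q , q≤p , ℚ.≤-refl

-- Clears denominators among the unnormalised rationals, where the sum has the literal numerator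
-- `p′ * q + p * q′` and no common divisor is cancelled.
fraction-sum : ∀ {p q p′ q′ N} .{{_ : NonZero q}} .{{_ : NonZero q′}} .{{_ : NonZero N}} →
  1ℚ ℚ.+ ℤ.+ 1 ℚ./ N ℚ.≤ ℤ.+ p′ ℚ./ q′ ℚ.+ ℤ.+ p ℚ./ q →
  suc N * (q * q′) ≤ N * (p′ * q + p * q′)
fraction-sum {p} {q@(suc q-1)} {p′} {q′@(suc q′-1)} {N@(suc N-1)} sum≤ = begin
  suc N * (q * q′)                   ≡⟨ cong (suc N *_) (*-comm q q′) ⟩
  suc N * (q′ * q)                   ≡⟨ cong (_* (q′ * q)) (trans (+-comm 1 N) (cong (_+ 1) (sym (*-identityˡ N)))) ⟩
  (1 * N + 1) * (q′ * q)             ≤⟨ ℤ.drop‿+≤+ (subst₂ ℤ._≤_ (sym (ℤ.pos-* (1 * N + 1) (q′ * q))) numerators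
                                          (ℚᵘ.drop-*≤* unnormalised)) ⟩
  (p′ * q + p * q′) * (1 * N)        ≡⟨ *-comm (p′ * q + p * q′) (1 * N) ⟩
  1 * N * (p′ * q + p * q′)          ≡⟨ cong (_* (p′ * q + p * q′)) (*-identityˡ N) ⟩
  N * (p′ * q + p * q′)              ∎
  where
  open ≤-Reasoning
  toℚᵘ-sum : ∀ x y → toℚᵘ (fromℚᵘ x ℚ.+ fromℚᵘ y) ℚᵘ.≃ x ℚᵘ.+ y
  toℚᵘ-sum x y = ℚᵘ.≃-trans (ℚ.toℚᵘ-homo-+ (fromℚᵘ x) (fromℚᵘ y))
    (ℚᵘ.+-cong (ℚ.toℚᵘ-fromℚᵘ x) (ℚ.toℚᵘ-fromℚᵘ y))

  unnormalised : ℚᵘ.1ℚᵘ ℚᵘ.+ ℚᵘ.mkℚᵘ (ℤ.+ 1) N-1 ℚᵘ.≤ ℚᵘ.mkℚᵘ (ℤ.+ p′) q′-1 ℚᵘ.+ ℚᵘ.mkℚᵘ (ℤ.+ p) q-1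
  unnormalised = ℚᵘ.≤-respʳ-≃ (toℚᵘ-sum (ℚᵘ.mkℚᵘ (ℤ.+ p′) q′-1) (ℚᵘ.mkℚᵘ (ℤ.+ p) q-1))
    (ℚᵘ.≤-respˡ-≃ (toℚᵘ-sum ℚᵘ.1ℚᵘ (ℚᵘ.mkℚᵘ (ℤ.+ 1) N-1)) (ℚ.toℚᵘ-mono-≤ sum≤))

  numerators : (ℤ.+ p′ ℤ.* ℤ.+ q ℤ.+ ℤ.+ p ℤ.* ℤ.+ q′) ℤ.* ℤ.+ (1 * N) ≡ ℤ.+ ((p′ * q + p * q′) * (1 * N))
  numerators = trans
    (cong (ℤ._* ℤ.+ (1 * N)) (trans (cong₂ ℤ._+_ (sym (ℤ.pos-* p′ q)) (sym (ℤ.pos-* p q′)))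
      (sym (ℤ.pos-+ (p′ * q) (p * q′)))))
    (sym (ℤ.pos-* (p′ * q + p * q′) (1 * N)))

unit-fraction : ∀ {τ} → 0ℚ ℚ.< τ → ∃[ N ] Σ[ N≢0 ∈ NonZero N ] (ℤ.+ 1 ℚ./ N) {{N≢0}} ℚ.≤ τ
unit-fraction {mkℚ ℤ.+[1+ m ] d c} _ = suc d , _ ,
  ℚ.toℚᵘ-cancel-≤ (ℚᵘ.≤-respˡ-≃ (ℚᵘ.≃-sym (ℚ.toℚᵘ-fromℚᵘ (ℚᵘ.mkℚᵘ (ℤ.+ 1) d)))
    (ℚᵘ.*≤* (ℤ.+≤+ (*-monoˡ-≤ (suc d) {1} {suc m} (s≤s z≤n)))))
unit-fraction {mkℚ ℤ.+0       d c} (ℚ.*<* (ℤ.+<+ ()))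
unit-fraction {mkℚ ℤ.-[1+ m ] d c} (ℚ.*<* ())

-- Differences are spelled p + (- q) here, the form to which _-ℝ_ unfolds: comparing
-- it with p - q would make Agda normalise the fractions.
private
  module _ where
    open ℚ.+-*-Solver

    four-quarters : ∀ θ → let τ = ½ ℚ.* (½ ℚ.* θ) in τ ℚ.+ τ ℚ.+ τ ℚ.+ τ ≡ θ
    four-quarters = solve 1 (λ θ → let t = con ½ :* (con ½ :* θ) in t :+ t :+ t :+ t := θ) refl

    4τ-2τ : ∀ τ → τ ℚ.+ τ ≡ τ ℚ.+ τ ℚ.+ τ ℚ.+ τ ℚ.+ ℚ.- (τ ℚ.+ τ)
    4τ-2τ = solve 1 (λ t → t :+ t := t :+ t :+ t :+ t :+ :- (t :+ t)) refl

    -2τ+τ : ∀ d τ → d ℚ.+ ℚ.- (τ ℚ.+ τ) ℚ.+ τ ≡ d ℚ.+ ℚ.- τ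
    -2τ+τ = solve 2 (λ d t → d :+ :- (t :+ t) :+ t := d :+ :- t) refl

    +τ-τ : ∀ d τ → d ℚ.+ τ ℚ.+ ℚ.- τ ≡ d
    +τ-τ = solve 2 (λ d t → d :+ t :+ :- t := d) refl

    -2τ+3τ : ∀ d τ → d ℚ.+ τ ≡ d ℚ.+ ℚ.- (τ ℚ.+ τ) ℚ.+ (τ ℚ.+ τ ℚ.+ τ)
    -2τ+3τ = solve 2 (λ d t → d :+ t := d :+ :- (t :+ t) :+ (t :+ t :+ t)) refl

    -- The budget behind the four quarters: δ exceeds r by at most 3τ, ε supplies 4τ, and the
    -- surplus τ makes room for `1 / N`. The `0ℚ` stands for the lower bound of the square.
    exponent-identity : ∀ r τ → 1ℚ ℚ.+ τ ≡
      1ℚ ℚ.+ ℚ.- ((r ℚ.+ (τ ℚ.+ τ ℚ.+ τ)) ℚ.+ ℚ.- 0ℚ ℚ.+ ℚ.- (τ ℚ.+ τ ℚ.+ τ ℚ.+ τ)) ℚ.+ r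
    exponent-identity = solve 2 (λ r t → con 1ℚ :+ t :=
      con 1ℚ :+ :- ((r :+ (t :+ t :+ t)) :+ :- con 0ℚ :+ :- (t :+ t :+ t :+ t)) :+ r) refl

quarter : ∀ {θ} → 0ℚ ℚ.< θ → ∃[ τ ] (0ℚ ℚ.< τ × τ ℚ.+ τ ℚ.+ τ ℚ.+ τ ≡ θ)
quarter {θ} 0<θ = ½ ℚ.* (½ ℚ.* θ) , halve (halve 0<θ) , four-quarters θ
  where
  halve : ∀ {x} → 0ℚ ℚ.< x → 0ℚ ℚ.< ½ ℚ.* x
  halve {x} 0<x = subst (ℚ._< ½ ℚ.* x) (ℚ.*-zeroʳ ½) (ℚ.*-monoʳ-<-pos ½ 0<x)

module _ (δ ε : ℝ) {τ δ₀ ε₀ : ℚ} {N₁ N₂ : ℕ} (0<τ : 0ℚ ℚ.< τ)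
  (4τ≤δ₀ : τ ℚ.+ τ ℚ.+ τ ℚ.+ τ ℚ.≤ δ₀) (4τ≤ε₀ : τ ℚ.+ τ ℚ.+ τ ℚ.+ τ ℚ.≤ ε₀)
  (δ₀≤ : ∀ n → N₁ ≤ n → 0ℚ ℚ.+ δ₀ ℚ.≤ seq δ n) (ε₀≤ : ∀ n → N₂ ≤ n → 0ℚ ℚ.+ ε₀ ℚ.≤ seq ε n) where

  private
    N₃ = proj₁ (cauchy δ τ 0<τ)
    K = (N₁ ⊔ N₂) ⊔ N₃

    close : ∀ m n → K ≤ m → K ≤ n → seq δ m ℚ.≤ seq δ n ℚ.+ τ
    close m n K≤m K≤n = ∣p-q∣<r⇒p≤q+r (seq δ m) (seq δ n) (proj₂ (cauchy δ τ 0<τ) m n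
      (≤-trans (m≤n⊔m (N₁ ⊔ N₂) N₃) K≤m) (≤-trans (m≤n⊔m (N₁ ⊔ N₂) N₃) K≤n))

    4τ≤ : ∀ x n {g} → τ ℚ.+ τ ℚ.+ τ ℚ.+ τ ℚ.≤ g → 0ℚ ℚ.+ g ℚ.≤ seq x n →
      τ ℚ.+ τ ℚ.+ τ ℚ.+ τ ℚ.≤ seq x n
    4τ≤ x n {g} ≤g g≤ = ℚ.≤-trans ≤g (subst (ℚ._≤ seq x n) (ℚ.+-identityˡ g) g≤)

    2τ≤r : τ ℚ.+ τ ℚ.≤ seq δ K ℚ.+ ℚ.- (τ ℚ.+ τ)
    2τ≤r = subst (ℚ._≤ seq δ K ℚ.+ ℚ.- (τ ℚ.+ τ)) (sym (4τ-2τ τ))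
      (ℚ.+-monoˡ-≤ (ℚ.- (τ ℚ.+ τ)) {τ ℚ.+ τ ℚ.+ τ ℚ.+ τ} {seq δ K}
        (4τ≤ δ K 4τ≤δ₀ (δ₀≤ K (≤-trans (m≤m⊔n N₁ N₂) (m≤m⊔n _ N₃)))))

  Below : ℚ → ℕ → Set
  Below r n = r ℚ.+ τ ℚ.≤ seq δ n × seq δ n ℚ.≤ r ℚ.+ (τ ℚ.+ τ ℚ.+ τ) × τ ℚ.+ τ ℚ.+ τ ℚ.+ τ ℚ.≤ seq ε n

  -- From index `K` on, δ varies by at most τ, so the value 2τ below its `K`-th term stays between τ
  -- and 3τ below all later terms. It is positive because that term is at least 4τ.
  rational-below : ∃[ r ] (0ℚ ℚ.< r × ∃[ K ] (∀ n → K ≤ n → Below r n))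
  rational-below = seq δ K ℚ.+ ℚ.- (τ ℚ.+ τ) ,
    ℚ.<-≤-trans 0<τ (ℚ.≤-trans (p≤p+q τ (ℚ.<⇒≤ 0<τ)) 2τ≤r) , K , λ n K≤n →
    subst (ℚ._≤ seq δ n) (sym (-2τ+τ (seq δ K) τ))
      (subst (seq δ K ℚ.+ ℚ.- τ ℚ.≤_) (+τ-τ (seq δ n) τ)
        (ℚ.+-monoˡ-≤ (ℚ.- τ) {seq δ K} {seq δ n ℚ.+ τ} (close K n ≤-refl K≤n))) ,
    subst (seq δ n ℚ.≤_) (-2τ+3τ (seq δ K) τ) (close n K K≤n ≤-refl) ,
    4τ≤ ε n 4τ≤ε₀ (ε₀≤ n (≤-trans (≤-trans (m≤n⊔m N₁ N₂) (m≤m⊔n _ N₃)) K≤n))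

-- For a rational r slightly below δ, the exponent 1 - δ + δ² + ε still exceeds 1 - r.
exponent-gap : ∀ δ ε {r τ t} n → seq δ n ℚ.≤ r ℚ.+ (τ ℚ.+ τ ℚ.+ τ) →
  τ ℚ.+ τ ℚ.+ τ ℚ.+ τ ℚ.≤ seq ε n → seq (1ℝ -ℝ (δ -ℝ δ *ℝ δ -ℝ ε)) n ℚ.≤ t →
  1ℚ ℚ.+ τ ℚ.≤ t ℚ.+ r
exponent-gap δ ε {r} {τ} {t} n δₙ≤ 4τ≤εₙ x≤t = begin
  1ℚ ℚ.+ τ                                          ≡⟨ exponent-identity r τ ⟩
  1ℚ ℚ.+ ℚ.- ((r ℚ.+ (τ ℚ.+ τ ℚ.+ τ)) ℚ.+ ℚ.- 0ℚ ℚ.+ ℚ.- (τ ℚ.+ τ ℚ.+ τ ℚ.+ τ)) ℚ.+ r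
    ≤⟨ ℚ.+-monoˡ-≤ r (ℚ.+-monoʳ-≤ 1ℚ (ℚ.neg-antimono-≤ (ℚ.+-mono-≤
         (ℚ.+-mono-≤ δₙ≤ (ℚ.neg-antimono-≤ (0≤p*p (seq δ n)))) (ℚ.neg-antimono-≤ 4τ≤εₙ)))) ⟩
  seq (1ℝ -ℝ (δ -ℝ δ *ℝ δ -ℝ ε)) n ℚ.+ r            ≤⟨ ℚ.+-monoˡ-≤ r x≤t ⟩
  t ℚ.+ r                                           ∎
  where open ℚ.≤-Reasoning

-- The last component serves to derive `p ≤ q` from the bound ½ on δ.
as-fraction : ∀ {r} → 0ℚ ℚ.< r → ∃[ p ] ∃[ q ] Σ[ p≢0 ∈ NonZero p ] Σ[ q≢0 ∈ NonZero q ]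
  ((ℤ.+ p ℚ./ q) {{q≢0}} ≡ r × (q < p → ½ ℚ.≤ r))
as-fraction {r@(mkℚ ℤ.+[1+ m ] d c)} _ = suc m , suc d , _ , _ , ℚ.↥p/↧p≡p r , λ q<p →
  ℚ.*≤* (ℤ.+≤+ (≤-trans (≤-reflexive (*-identityˡ (suc d))) (≤-trans (<⇒≤ q<p) (m≤m*n (suc m) 2))))
as-fraction {mkℚ ℤ.+0       d c} (ℚ.*<* (ℤ.+<+ ()))
as-fraction {mkℚ ℤ.-[1+ m ] d c} (ℚ.*<* ())

RationalExponent : ℝ → ℝ → Set
RationalExponent δ ε =
  ∃[ p ] ∃[ q ] ∃[ N ] Σ[ p≢0 ∈ NonZero p ] Σ[ q≢0 ∈ NonZero q ] Σ[ N≢0 ∈ NonZero N ]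
    (fromℚ ((ℤ.+ p ℚ./ q) {{q≢0}}) <ℝ δ × p ≤ q ×
    (∀ p′ q′ → .{{_ : NonZero q′}} → 1ℝ -ℝ (δ -ℝ δ *ℝ δ -ℝ ε) <ℝ fromℚ (ℤ.+ p′ ℚ./ q′) →
      suc N * (q * q′) ≤ N * (p′ * q + p * q′)))

rational-exponent : ∀ δ ε → 0ℝ <ℝ δ → δ ≤ℝ ½ℝ → 0ℝ <ℝ ε → RationalExponent δ ε
rational-exponent δ ε (δ₀ , 0<δ₀ , N₁ , δ₀≤) δ≤½ (ε₀ , 0<ε₀ , N₂ , ε₀≤) =
  let θ , 0<θ , θ≤δ₀ , θ≤ε₀ = common-lower-bound 0<δ₀ 0<ε₀
      τ , 0<τ , 4τ≡θ = quarter 0<θ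
      r , 0<r , K , bounds = rational-below δ ε 0<τ (subst (ℚ._≤ δ₀) (sym 4τ≡θ) θ≤δ₀)
                               (subst (ℚ._≤ ε₀) (sym 4τ≡θ) θ≤ε₀) δ₀≤ ε₀≤
  in assemble 0<τ 0<r bounds
  where
  assemble : ∀ {τ r K} (0<τ : 0ℚ ℚ.< τ) → 0ℚ ℚ.< r →
    (∀ n → K ≤ n → r ℚ.+ τ ℚ.≤ seq δ n × seq δ n ℚ.≤ r ℚ.+ (τ ℚ.+ τ ℚ.+ τ) ×
                   τ ℚ.+ τ ℚ.+ τ ℚ.+ τ ℚ.≤ seq ε n) →
    RationalExponent δ ε
  assemble {τ} {r} {K} 0<τ 0<r bounds =
    let N , N≢0 , 1/N≤τ = unit-fraction 0<τ
        p , q , p≢0 , q≢0 , p/q≡r , ½≤r = as-fraction 0<r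
    in p , q , N , p≢0 , q≢0 , N≢0 ,
       (τ , 0<τ , K , λ n K≤n → subst (λ s → s ℚ.+ τ ℚ.≤ seq δ n) (sym p/q≡r) (proj₁ (bounds n K≤n))) ,
       -- If `q < p`, then `½ ≤ r`, and as r lies τ below the terms of δ, δ would be strictly above
       -- ½.
       ≮⇒≥ (λ q<p → δ≤½ (τ , 0<τ , K , λ n K≤n →
         ℚ.≤-trans (ℚ.+-monoˡ-≤ τ (½≤r q<p)) (proj₁ (bounds n K≤n)))) ,
       λ p′ q′ {{q′≢0}} (g , 0<g , M , below) →
         -- The desired inequality is between rationals, so one index past both thresholds is
         -- enough.
         let _ , δₙ≤ , 4τ≤εₙ = bounds (K ⊔ M) (m≤m⊔n K M)
         in fraction-sum {p} {q} {p′} {q′} {N} {{q≢0}} {{q′≢0}} {{N≢0}}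
              (ℚ.≤-trans (ℚ.+-monoʳ-≤ 1ℚ 1/N≤τ)
                (subst (λ s → 1ℚ ℚ.+ τ ℚ.≤ ℤ.+ p′ ℚ./ q′ ℚ.+ s) (sym p/q≡r)
                  (exponent-gap δ ε {r} {τ} (K ⊔ M) δₙ≤ 4τ≤εₙ
                    (ℚ.≤-trans (p≤p+q _ (ℚ.<⇒≤ 0<g)) (below (K ⊔ M) (m≤n⊔m K M))))))

-- The approximation algorithm

answerBound : ℕ → ℕ
answerBound zero    = 0
answerBound (suc N) = answerTime N + answerBound N

answerTime≤ : ∀ {n N} → n < N → answerTime n ≤ answerBound N
answerTime≤ {n} {suc N} n<1+N with n ≟ N
... | yes refl = m≤m+n _ _
... | no n≢N   = ≤-trans (answerTime≤ (≤∧≢⇒< (s≤s⁻¹ n<1+N) n≢N)) (m≤n+m _ _)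

-- For positive n the factor `n ^ p` is at least 1. For n = 0 it may vanish, but then `α G` is 0,
-- and so is its `q`-th power as `q` is nonzero.
maximum-quotient : ∀ {n} (G : Graph n) (I : Subset n) x → α G ≤ ∣ I ∣ → QuotientAtMost (α G) n x ∣ I ∣
maximum-quotient {zero}  G I x α≤∣I∣ p q _ =
  ≤-trans (≤-reflexive (trans (cong (_^ q) (n≤0⇒n≡0 (≤-trans α≤∣I∣ (∣p∣≤n I)))) (0^n≡0 q))) z≤n
maximum-quotient {suc n} G I x α≤∣I∣ p q _ =
  ≤-trans (^-monoˡ-≤ q α≤∣I∣) (m≤m*n (∣ I ∣ ^ q) (suc n ^ p) {{m^n≢0 (suc n) p}})

approximation : ∀ {h} (H : Graph h) (δ x : ℝ) p q N .{{_ : NonZero p}} .{{_ : NonZero q}} .{{_ : NonZero N}} →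
  fromℚ (ℤ.+ p ℚ./ q) <ℝ δ → p ≤ q →
  (∀ p′ q′ → .{{_ : NonZero q′}} → x <ℝ fromℚ (ℤ.+ p′ ℚ./ q′) → suc N * (q * q′) ≤ N * (p′ * q + p * q′)) →
  PolyTimeAlgorithm (H -Free_) (λ {n} G S →
    (IsClique G S ⊎ IsIndependent G S) × PowerAtMost n δ ∣ S ∣) →
  PolyTimeAlgorithm (H -Free_) (λ {n} G I → IsIndependent G I × QuotientAtMost (α G) n x ∣ I ∣)
approximation H δ x p q N p/q<δ p≤q gap (A , c , d , spec) = program , polyC , polyD , run
  where
  n₀ = proj₁ (few-sets {p} {q} p≤q N)
  few = proj₂ (few-sets {p} {q} p≤q N)
  -- The successor guarantees that the empty graph goes to the table: peeling starts from the vertex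
  -- `zero`.
  N₀ = suc n₀
  program = bySize N₀ 0 X answer (peelAll A)

  oracleTime time : ℕ → ℕ
  oracleTime n = c * n ^ d + c
  time n = bySizeTime N₀ X + (answerBound N₀ + peelAllTime n (oracleTime n))

  time-bound = polynomial-bound {time} (constant-polynomial (bySizeTime N₀ X) +ᵖ (constant-polynomial (answerBound N₀) +ᵖ
    peelAllTime-polynomial (constant-polynomial c *ᵖ ^-polynomial d +ᵖ constant-polynomial c)))
  polyC = proj₁ time-bound
  polyD = proj₁ (proj₂ time-bound)

  Good : ∀ {n} → Graph n → Subset n → Set
  Good {n} G I = IsIndependent G I × QuotientAtMost (α G) n x ∣ I ∣

  solve : ∀ {n} (G : Graph n) → H -Free G →
    ∃[ I ] (Good G I × program ⊢ encodeGraph G ⇒ encodeSubset I within time n)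
  solve {n} G free with n <? N₀
  ... | yes n<N₀ =
    let I , independent , α≤∣I∣ , runs = answer-run G
    in I , (independent , maximum-quotient G I x α≤∣I∣) ,
       relax (+-monoʳ-≤ (bySizeTime N₀ X) (m≤m+n (answerBound N₀) _))
         (bySize-small N₀ 0 X (subst (_< N₀) (sym len≡n) n<N₀)
           (relax (answerTime≤ n<N₀)
             (subst (λ m → answer m ⊢ encodeGraph G ⇒ encodeSubset I within answerTime n) (sym len≡n) runs)))
    where
    len≡n : len (encodeGraph G) ≡ n
    len≡n = len-encodeVec (encodeVec encodeBool) (matrix G)
  solve {suc n} G free | no n≮N₀ =
    let B , k , peeling , independent , α≤k∣B∣ , runs = peelAll-run {A} {oracleTime (suc n)} {p} {q} G oracle
    in B , (independent , λ p′ q′ x<p′/q′ → begin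
         α G ^ q′                    ≤⟨ ^-monoˡ-≤ q′ α≤k∣B∣ ⟩
         (k * ∣ B ∣) ^ q′            ≡⟨ ^-distribʳ-* q′ k ∣ B ∣ ⟩
         k ^ q′ * ∣ B ∣ ^ q′         ≤⟨ *-monoˡ-≤ (∣ B ∣ ^ q′)
                                         (few (<⇒≤ (≮⇒≥ n≮N₀)) peeling p′ q′ (gap p′ q′ x<p′/q′)) ⟩
         suc n ^ p′ * ∣ B ∣ ^ q′     ≡⟨ *-comm (suc n ^ p′) (∣ B ∣ ^ q′) ⟩
         ∣ B ∣ ^ q′ * suc n ^ p′     ∎) ,
       relax (+-monoʳ-≤ (bySizeTime N₀ X) (m≤n+m _ (answerBound N₀)))
         (bySize-large N₀ 0 X (subst (N₀ ≤_) (sym len≡n) (≮⇒≥ n≮N₀)) runs)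
    where
    open ≤-Reasoning
    len≡n : len (encodeGraph G) ≡ suc n
    len≡n = len-encodeVec (encodeVec encodeBool) (matrix G)

    oracle : ∀ M → ∃[ S ] (A ⊢ encodeGraph (induce G M) ⇒ encodeSubset S within oracleTime (suc n) ×
      (IsClique (induce G M) S ⊎ IsIndependent (induce G M) S) × ∣ M ∣ ^ p ≤ ∣ S ∣ ^ q)
    oracle M =
      let S , k , runs , k≤ , homogeneous , large = spec (induce G M) (induce-free H G M free)
      in S , (k , runs , ≤-trans k≤ (+-monoˡ-≤ c (*-monoʳ-≤ c (^-monoˡ-≤ d (∣p∣≤n M))))) ,
         homogeneous , large p q p/q<δ
  solve {zero} G free | no n≮N₀ with () ← n≮N₀ (s≤s z≤n)

  run : ∀ {n} (G : Graph n) → H -Free G → ∃[ I ] ∃[ k ] (program ⊢ encodeGraph G ⇒ encodeSubset I [ k ]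
    × k ≤ polyC * n ^ polyD + polyC × Good G I)
  run {n} G free =
    let I , good , k , runs , k≤ = solve G free
    in I , k , runs , ≤-trans k≤ (proj₂ (proj₂ time-bound) n) , good

theorem6 : ∀ {h : ℕ} (H : Graph h) (δ : ℝ) → 0ℝ <ℝ δ → δ ≤ℝ ½ℝ →
    PolyTimeAlgorithm (H -Free_) (λ {n} G S →
    (IsClique G S ⊎ IsIndependent G S) × PowerAtMost n δ ∣ S ∣) →
    ∀ (ε : ℝ) → 0ℝ <ℝ ε →
    ImprovedApproximation H (δ -ℝ δ *ℝ δ -ℝ ε)
theorem6 H δ 0<δ δ≤½ algorithm ε 0<ε =
  let p , q , N , p≢0 , q≢0 , N≢0 , p/q<δ , p≤q , gap = rational-exponent δ ε 0<δ δ≤½ 0<ε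
  in approximation H δ (1ℝ -ℝ (δ -ℝ δ *ℝ δ -ℝ ε)) p q N {{p≢0}} {{q≢0}} {{N≢0}} p/q<δ p≤q gap algorithm
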